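{- Let $G=(V,E)$ be a directed acyclic graph, let $S_c=\{C_1,\dots,C_k\}$ be a channel decomposition of $G$, and let $Q=(V,I)$ be the associated compressed transitive closure graph. Then $S_c'=\text{Best-Order}(Q,S_c)$ is an ordered channel decomposition such that the drawing $\Gamma=\text{CCH-Draw}(S_c',Q)$ has minimum $\theta$ among all ordered channel decompositions having the same channels as $S_c$. Furthermore, Algorithm Best-Order runs in $O(k!\,k^2+|I|)$ time.
   Context: Let $G=(V,E)$ be a DAG. Here "a vertex $w$ is reached from (reachable from) $v$" means there is a directed path with at least one edge from $v$ to $w$ in $G$. A channel $C$ is an ordered set of vertices such that for any two distinct $v,w\in C$, $v$ precedes $w$ in the order of $C$ if and only if $w$ is reachable from $v$ in $G$. A channel decomposition $S_c=\{C_1,\dots,C_k\}$ is a partition of $V$ into channels. An ordered channel decomposition is a channel decomposition together with a linear order $ord$ of its channels ($ord(C)\in\{1,\dots,k\}$ denotes the position of $C$). For each $v\in V$ let $L_v$ be the list of vertices such that: $L_v$ contains at most one vertex of each channel of $S_c$; and a vertex $w$ is reached from $v$ in $G$ if and only if $L_v$ contains a vertex $w'$ in the same channel as $w$ with $w'=w$ or $w'$ preceding $w$ in the order of that channel. The compressed transitive closure graph is $Q=(V,I)$, where $(u,v)\in I$ if and only if $v\in L_u$ and $u$ is the highest (i.e. last) vertex in the order of its channel with $v\in L_u$. An edge of $Q$ joining vertices of two different channels is a cross edge. Algorithm CCH-Draw, given an ordered channel decomposition, draws all vertices of a channel $C$ on the vertical line $x=X(C)=2\,ord(C)$ (each vertex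 $v$ having $y$-coordinate its position in a fixed topological order), so the left-to-right order of the channels in $\Gamma$ is $ord$. For distinct channels $C_i,C_j$ let $m_{ij}$ be the number of cross edges $(u,v)\in I$ with $u\in C_i$, $v\in C_j$, and let $k_{ij}=|ord(C_i)-ord(C_j)|-1$ be the number of channels lying strictly between $C_i$ and $C_j$ in $\Gamma$. Define $$\theta=\sum_{(C_i,C_j)} m_{ij}k_{ij},$$ the sum being over ordered pairs of distinct channels. Algorithm Best-Order$(Q,S_c)$: initialize all $m_{ij}=0$; for every cross edge $(u,v)\in I$ with $u\in C_i$, $v\in C_j$, increase $m_{ij}$ by one; set $\theta_m=+\infty$; for every one of the possible orders $ord$ of the channels of $S_c$, compute $k_{ij}=|ord(C_i)-ord(C_j)|-1$ for every pair of distinct channels, compute $\theta=\sum m_{ij}k_{ij}$, and if $\theta<\theta_m$ set $\theta_m=\theta$ and $ord_m=ord$; output $S_c'$, the channels of $S_c$ ordered as in $ord_m$. (The channel containing a given vertex is assumed to be available in constant time.) -}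

module Defs where

open import Data.Bool using (Bool; true; false; if_then_else_)
open import Data.Nat
  using (ℕ; zero; suc; _+_; _*_; _∸_; _/_; _%_; _<_; _<ᵇ_; _≡ᵇ_; ∣_-_∣; _<?_)
open import Data.Nat.Properties using (+-0-commutativeMonoid)
open import Data.Fin using (Fin; toℕ)
import Data.Fin as Fin
import Data.Fin.Properties as Fin
open import Data.Fin.Permutation using (Permutation′; _⟨$⟩ʳ_)
open import Data.List using (List; []; length; lookup; filter; allFin)
open import Data.List.Membership.Propositional using (_∈_)
open import Data.List.Relation.Unary.Unique.Propositional using (Unique)
open import Data.Product using (_×_; _,_; proj₁; proj₂; ∃; ∃₂; ∃!)
open import Data.Sum using (_⊎_)
open import Function.Bundles using (_⇔_)
open import Level using (0ℓ)
open import Relation.Binary.Core using (Rel)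
open import Relation.Binary.Construct.Closure.Transitive using (TransClosure)
open import Relation.Binary.PropositionalEquality using (_≡_; _≢_)
open import Relation.Nullary using (¬_; does; _×-dec_; _⊎-dec_)

import Data.List.Membership.DecPropositional as DecMembership
open import Algebra.Properties.CommutativeMonoid.Sum +-0-commutativeMonoid
  using (sum)

------------------------------------------------------------------------
-- Graphs and channel decompositions

record DAG (n : ℕ) : Set₁ where
  field
    _⟶_     : Rel (Fin n) 0ℓ
    acyclic : ∀ v → ¬ TransClosure _⟶_ v v

  -- At least one edge is needed, so no vertex reaches itself.
  Reaches : Rel (Fin n) 0ℓ
  Reaches = TransClosure _⟶_

Precedes : ∀ {A : Set} → List A → A → A → Set
Precedes C v w = ∃₂ λ i j → lookup C i ≡ v × lookup C j ≡ w × i Fin.< j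

module _ {n : ℕ} (G : DAG n) where
  open DAG G

  record IsChannel (C : List (Fin n)) : Set where
    field
      unique : Unique C
      order  : ∀ {v w} → v ∈ C → w ∈ C → v ≢ w → Precedes C v w ⇔ Reaches v w

  record ChannelDecomposition : Set where
    field
      size      : ℕ
      channel   : Fin size → List (Fin n)
      isChannel : ∀ i → IsChannel (channel i)
      nonempty  : ∀ i → channel i ≢ []
      partition : ∀ v → ∃! _≡_ λ i → v ∈ channel i

    channelOf : Fin n → Fin size
    channelOf v = proj₁ (partition v)

    infix 4 _≼_

    -- w′ lies in the channel of w, at or before w.
    _≼_ : Rel (Fin n) 0ℓ
    w′ ≼ w = channelOf w′ ≡ channelOf w ×
             (w′ ≡ w ⊎ Precedes (channel (channelOf w)) w′ w)

  record OrderedChannelDecomposition : Set where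
    field
      decomposition : ChannelDecomposition
    open ChannelDecomposition decomposition public
    field
      order : Permutation′ size

    -- Positions are 1, …, size.
    ord : Fin size → ℕ
    ord i = suc (toℕ (order ⟨$⟩ʳ i))

  record TopologicalOrder : Set where
    field
      rank     : Permutation′ n
      monotone : ∀ {v w} → v ⟶ w → rank ⟨$⟩ʳ v Fin.< rank ⟨$⟩ʳ w

module _ {n : ℕ} {G : DAG n} where
  open DAG G

  -- Equality of the underlying sets of channels; the numbering of the
  -- channels may differ.
  SameChannels : ChannelDecomposition G → ChannelDecomposition G → Set
  SameChannels S T = ∀ C → (∃ λ i → S.channel i ≡ C) ⇔ (∃ λ j → T.channel j ≡ C)
    where
    module S = ChannelDecomposition S
    module T = ChannelDecomposition T

  -- Q = (V , I), where V = Fin n and I is given as a duplicate-free list.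
  record IsCompressedClosure (S : ChannelDecomposition G)
                             (I : List (Fin n × Fin n)) : Set where
    open ChannelDecomposition S
    field
      L             : Fin n → List (Fin n)
      L-oneEach     : ∀ v {w w′} → w ∈ L v → w′ ∈ L v →
                      channelOf w ≡ channelOf w′ → w ≡ w′
      L-reach       : ∀ v w → Reaches v w ⇔ (∃ λ w′ → w′ ∈ L v × w′ ≼ w)
      I-unique      : Unique I
      I-edge        : ∀ u v → (u , v) ∈ I ⇔
                      (v ∈ L u ×
                       (∀ u′ → channelOf u′ ≡ channelOf u → v ∈ L u′ → u′ ≼ u))

------------------------------------------------------------------------
-- Drawings

module _ {n : ℕ} {G : DAG n} where

  record Drawing (S : ChannelDecomposition G) : Set where
    open ChannelDecomposition S
    field
      X     : Fin size → ℕ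
      coord : Fin n → ℕ × ℕ
      edges : List (Fin n × Fin n)

  CCHDraw : (O : OrderedChannelDecomposition G) → List (Fin n × Fin n) →
            TopologicalOrder G →
            Drawing (OrderedChannelDecomposition.decomposition O)
  CCHDraw O I τ = record
    { X     = X
    ; coord = λ v → X (channelOf v) , suc (toℕ (rank ⟨$⟩ʳ v))
    ; edges = I
    }
    where
    open OrderedChannelDecomposition O
    open TopologicalOrder τ
    X : Fin size → ℕ
    X i = 2 * ord i

  module _ {S : ChannelDecomposition G} (Γ : Drawing S) where
    open ChannelDecomposition S
    open Drawing Γ
    open DecMembership (Fin._≟_ {n}) using (_∈?_)

    -- m_ij: for i ≢ j every edge counted is a cross edge.
    crossEdges : Fin size → Fin size → ℕ
    crossEdges i j =
      length (filter (λ e → (proj₁ e ∈? channel i) ×-dec (proj₂ e ∈? channel j))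
                     edges)

    -- k_ij: the number of channels drawn strictly between channels i and j,
    -- which is |ord i - ord j| - 1 when Γ is drawn by CCHDraw and i ≢ j.
    between : Fin size → Fin size → ℕ
    between i j =
      length (filter (λ c → ((X i <? X c) ×-dec (X c <? X j)) ⊎-dec
                            ((X j <? X c) ×-dec (X c <? X i)))
                     (allFin size))

    θ : ℕ
    θ = sum λ i → sum λ j →
          if does (i Fin.≟ j) then 0 else crossEdges i j * between i j

------------------------------------------------------------------------
-- A unit-cost random access machine with for-loops.  Variables, arrays and
-- matrices are named by natural numbers.

infix  9 _⟨_⟩ _⟨_⟩⟨_⟩
infix  4 _≔_ _⟨_⟩≔_ _⟨_⟩⟨_⟩≔_
infixr 3 _⨾_

data Op : Set where
  add mul sub dist quo rem lt eq or : Op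

data Expr : Set where
  lit     : ℕ → Expr
  var     : ℕ → Expr
  _⟨_⟩    : ℕ → Expr → Expr
  _⟨_⟩⟨_⟩  : ℕ → Expr → Expr → Expr
  op      : Op → Expr → Expr → Expr

data Stmt : Set where
  _≔_      : ℕ → Expr → Stmt
  _⟨_⟩≔_   : ℕ → Expr → Expr → Stmt
  _⟨_⟩⟨_⟩≔_ : ℕ → Expr → Expr → Expr → Stmt
  _⨾_      : Stmt → Stmt → Stmt
  when     : Expr → Stmt → Stmt
  for      : ℕ → Expr → Stmt → Stmt

record State : Set where
  field
    scalar : ℕ → ℕ
    array  : ℕ → ℕ → ℕ
    matrix : ℕ → ℕ → ℕ → ℕ
open State public

_[_↦_] : {A : Set} → (ℕ → A) → ℕ → A → (ℕ → A)
(f [ x ↦ a ]) y = if x ≡ᵇ y then a else f y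

setScalar : ℕ → ℕ → State → State
setScalar x a σ = record σ { scalar = scalar σ [ x ↦ a ] }

setArray : ℕ → ℕ → ℕ → State → State
setArray x i a σ = record σ { array = array σ [ x ↦ array σ x [ i ↦ a ] ] }

setMatrix : ℕ → ℕ → ℕ → ℕ → State → State
setMatrix x i j a σ = record σ
  { matrix = matrix σ [ x ↦ matrix σ x [ i ↦ matrix σ x i [ j ↦ a ] ] ] }

fromBool : Bool → ℕ
fromBool b = if b then 1 else 0

-- Truth values are numbers, nonzero meaning true; division by zero gives zero.
apply : Op → ℕ → ℕ → ℕ
apply add  a b       = a + b
apply mul  a b       = a * b
apply sub  a b       = a ∸ b
apply dist a b       = ∣ a - b ∣
apply quo  a zero    = 0
apply quo  a (suc b) = a / suc b
apply rem  a zero    = 0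
apply rem  a (suc b) = a % suc b
apply lt   a b       = fromBool (a <ᵇ b)
apply eq   a b       = fromBool (a ≡ᵇ b)
apply or   zero    b = b
apply or   (suc a) b = 1

eval : Expr → State → ℕ
eval (lit a)         σ = a
eval (var x)         σ = scalar σ x
eval (x ⟨ e ⟩)       σ = array σ x (eval e σ)
eval (x ⟨ e ⟩⟨ e′ ⟩)  σ = matrix σ x (eval e σ) (eval e′ σ)
eval (op o e e′)     σ = apply o (eval e σ) (eval e′ σ)

cost : Expr → ℕ
cost (lit a)        = 1
cost (var x)        = 1
cost (x ⟨ e ⟩)      = 1 + cost e
cost (x ⟨ e ⟩⟨ e′ ⟩) = 1 + (cost e + cost e′)
cost (op o e e′)    = 1 + (cost e + cost e′)

-- Performs the iterations 0, …, m - 1 in this order, adding up the times.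
iterate : (ℕ → State → State × ℕ) → ℕ → State → State × ℕ
iterate f zero    σ = σ , 0
iterate f (suc m) σ =
  let σ₁ , t₁ = iterate f m σ
      σ₂ , t₂ = f m σ₁
  in  σ₂ , t₁ + t₂

-- Final state and number of steps.  The number of iterations of a for-loop is
-- fixed on entry; each iteration is charged one step for setting the loop
-- variable.
exec : Stmt → State → State × ℕ
exec (x ≔ e)             σ = setScalar x (eval e σ) σ , 1 + cost e
exec (x ⟨ i ⟩≔ e)        σ = setArray x (eval i σ) (eval e σ) σ ,
                             1 + (cost i + cost e)
exec (x ⟨ i ⟩⟨ j ⟩≔ e)    σ = setMatrix x (eval i σ) (eval j σ) (eval e σ) σ ,
                             1 + (cost i + cost j + cost e)
exec (s ⨾ s′)            σ =
  let σ₁ , t₁ = exec s σ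
      σ₂ , t₂ = exec s′ σ₁
  in  σ₂ , t₁ + t₂
exec (when e s)          σ with eval e σ
... | zero  = σ , 1 + cost e
... | suc _ = let σ₁ , t = exec s σ in σ₁ , 1 + cost e + t
exec (for x e s)         σ =
  let σ₁ , t = iterate (λ i σ′ → let σ″ , t = exec s (setScalar x i σ′)
                                 in  σ″ , 1 + t)
                       (eval e σ) σ
  in  σ₁ , 1 + cost e + t

------------------------------------------------------------------------
-- Best-Order

module BestOrder where

  -- scalars
  pattern #channels = 0
  pattern #edges    = 1
  pattern i         = 2
  pattern j         = 3
  pattern e         = 4
  pattern a         = 5
  pattern b         = 6
  pattern #orders   = 7
  pattern t         = 8
  pattern code      = 9
  pattern d         = 10
  pattern θcur      = 11
  pattern θm        = 12
  pattern finite    = 13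

  -- arrays
  pattern src       = 0
  pattern tgt       = 1
  pattern chan      = 2
  pattern ordcur    = 3
  pattern ordm      = 4

  -- matrices
  pattern m         = 0
  pattern k         = 1

  countCrossEdges : Stmt
  countCrossEdges =
    for i (var #channels) (for j (var #channels) (
      m ⟨ var i ⟩⟨ var j ⟩≔ lit 0 )) ⨾
    for e (var #edges) (
      a ≔ chan ⟨ src ⟨ var e ⟩ ⟩ ⨾
      b ≔ chan ⟨ tgt ⟨ var e ⟩ ⟩ ⨾
      when (op eq (op eq (var a) (var b)) (lit 0)) (
        m ⟨ var a ⟩⟨ var b ⟩≔ op add (m ⟨ var a ⟩⟨ var b ⟩) (lit 1) ))

  countOrders : Stmt
  countOrders =
    #orders ≔ lit 1 ⨾
    for i (var #channels) (
      #orders ≔ op mul (var #orders) (op add (var i) (lit 1)) )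

  -- Writes the t-th order to ordcur.  The digits of t in the mixed radix
  -- 1, 2, …, k drive an inside-out Fisher–Yates shuffle, so that every order
  -- arises from exactly one t < k!.
  decodeOrder : Stmt
  decodeOrder =
    code ≔ var t ⨾
    for i (var #channels) (
      d    ≔ op rem (var code) (op add (var i) (lit 1)) ⨾
      code ≔ op quo (var code) (op add (var i) (lit 1)) ⨾
      ordcur ⟨ var i ⟩≔ ordcur ⟨ var d ⟩ ⨾
      ordcur ⟨ var d ⟩≔ op add (var i) (lit 1) )

  computeK : Stmt
  computeK =
    for i (var #channels) (for j (var #channels) (
      when (op eq (op eq (var i) (var j)) (lit 0)) (
        k ⟨ var i ⟩⟨ var j ⟩≔
          op sub (op dist (ordcur ⟨ var i ⟩) (ordcur ⟨ var j ⟩)) (lit 1) )))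

  computeθ : Stmt
  computeθ =
    θcur ≔ lit 0 ⨾
    for i (var #channels) (for j (var #channels) (
      when (op eq (op eq (var i) (var j)) (lit 0)) (
        θcur ≔ op add (var θcur)
                 (op mul (m ⟨ var i ⟩⟨ var j ⟩) (k ⟨ var i ⟩⟨ var j ⟩)) )))

  -- θm = +∞ is represented by finite = 0.
  keepBest : Stmt
  keepBest =
    when (op or (op eq (var finite) (lit 0)) (op lt (var θcur) (var θm))) (
      θm     ≔ var θcur ⨾
      finite ≔ lit 1 ⨾
      for i (var #channels) (
        ordm ⟨ var i ⟩≔ ordcur ⟨ var i ⟩ ))

  bestOrder : Stmt
  bestOrder =
    countCrossEdges ⨾
    countOrders ⨾
    finite ≔ lit 0 ⨾
    for t (var #orders) (
      decodeOrder ⨾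
      computeK ⨾
      computeθ ⨾
      keepBest )

  -- The memory holds the edges of Q and the channel of each vertex; everything
  -- else is arbitrary.
  record Input {n : ℕ} {G : DAG n} (S : ChannelDecomposition G)
               (I : List (Fin n × Fin n)) (σ : State) : Set where
    open ChannelDecomposition S
    field
      channels-≡ : scalar σ #channels ≡ size
      edges-≡    : scalar σ #edges ≡ length I
      src-≡      : ∀ x → array σ src (toℕ x) ≡ toℕ (proj₁ (lookup I x))
      tgt-≡      : ∀ x → array σ tgt (toℕ x) ≡ toℕ (proj₂ (lookup I x))
      chan-≡     : ∀ v → array σ chan (toℕ v) ≡ toℕ (channelOf v)

  time : State → ℕ
  time σ = proj₂ (exec bestOrder σ)

  -- The run from σ returns the channels of S, ordered by O.
  record Returns {n : ℕ} {G : DAG n} (S : ChannelDecomposition G) (σ : State)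
                 (O : OrderedChannelDecomposition G) : Set where
    open OrderedChannelDecomposition O
    field
      same-decomposition : decomposition ≡ S
      ordm-≡ : ∀ c → array (proj₁ (exec bestOrder σ)) ordm (toℕ c) ≡ ord c

{-# OPTIONS --safe #-}

-- A run of the algorithm is followed by loop invariants which bound the number
-- of steps along the way.  An order ord contributes
-- Σ_{i ≠ j} m_ij (|ord i - ord j| - 1), and the channels drawn strictly between
-- channels i and j are exactly those with a position strictly between ord i and
-- ord j, so this sum is θ of the drawing.  The minimum over the codes t < k! is a
-- minimum over all orders because the shuffle driven by the factorial-base digits
-- of t can be undone: the last digit is the place of the largest position, and
-- removing it leaves a smaller permutation.

module Submission where

open import Data.Bool using (Bool; true; false; _∨_; _∧_; if_then_else_)
open import Data.Bool.Properties using (∨-conicalˡ; ∨-conicalʳ)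
open import Data.Fin using (Fin; toℕ; fromℕ; punchIn; punchOut)
import Data.Fin as Fin
import Data.Fin.Properties as Fin
open import Data.Fin.Permutation using
  ( Permutation; Permutation′; _⟨$⟩ʳ_; _⟨$⟩ˡ_; _∘ₚ_; insert; remove; transpose
  ; permutation; inverseʳ; insert-remove )
import Data.Fin.Permutation as Permutation
import Data.Fin.Permutation.Components as Components
open import Data.List using (List; []; _∷_; length; filter; tabulate; lookup)
open import Data.List.Properties using (tabulate-lookup)
open import Data.List.Membership.Propositional using (_∈_)
import Data.List.Membership.DecPropositional as DecMembership
open import Data.List.Relation.Unary.Any using (here)
open import Data.Nat using
  ( ℕ; zero; suc; _+_; _*_; _∸_; _/_; _%_; _^_; _!; _⊓_; ∣_-_∣; _≤_; _<_; _≡ᵇ_; z≤n; s≤s )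
open import Data.Nat.Divisibility using (n∣m*n)
open import Data.Nat.DivMod using
  ( _mod_; m%n<n; [m+kn]%n≡m%n; m<n⇒m%n≡m; +-distrib-/-∣ʳ; m<n⇒m/n≡0; m*n/n≡m )
open import Data.Nat.Properties
open import Data.Nat.Solver using (module +-*-Solver)
open import Data.Product using (_×_; _,_; proj₁; proj₂; ∃; ∃-syntax) renaming (map to map×)
open import Data.Sum using (_⊎_; inj₁; inj₂; map; swap)
open import Function using (_∘_; _⇔_; mk⇔; Equivalence; Injection)
open import Function.Properties.Inverse using (↔⇒↣)
open import Relation.Binary.PropositionalEquality using
  ( _≡_; _≢_; refl; sym; trans; cong; cong₂; subst; module ≡-Reasoning )
open import Relation.Nullary using (Dec; does; yes; no; contradiction; _×-dec_; _⊎-dec_)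
open import Relation.Nullary.Decidable using (dec-true; dec-false; does-⇔)
open import Relation.Unary using (Decidable)
open import Algebra.Properties.CommutativeMonoid.Sum +-0-commutativeMonoid using
  ( sum; sum-init-last; sum-cong-≗; sum-permute )
open import Defs
open ChannelDecomposition using (size)
open OrderedChannelDecomposition using (decomposition)
open BestOrder using (Input; Returns; time)
-- The one-letter names are pattern synonyms and would capture bound variables.
open BestOrder hiding (Input; Returns; time)
  renaming (i to 𝐢; j to 𝐣; e to 𝐞; a to 𝐚; b to 𝐛; t to 𝐭; d to 𝐝; m to 𝐦; k to 𝐤)

-- Programs and their running times

-- A stage relies on values left by earlier stages, and the memory is arbitrary apart from the
-- input, so much of the correctness proof consists of claims that something has not been
-- overwritten. `writes` decides these from the program text: for a concrete program such a claim is
-- proved by `refl`, and `runs-for` hands it to every iteration, so that loop invariants mention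
-- only what the loop changes. The diagonals of `m` and `k` never enter the cost; the facts about
-- these matrices are stated for distinct channels only. A competing decomposition may number the
-- same channels differently, and its size is only provably equal to that of `S`. All costs are
-- therefore written in the numbering of `S`, with orders as bijections `Permutation K L` between
-- possibly different index sets. Only differences of positions occur in a cost, so counting from 0
-- in `Fin` and from 1 in memory gives the same value.

≡ᵇ-true : ∀ {x y} → x ≡ y → (x ≡ᵇ y) ≡ true
≡ᵇ-true {x} {y} = dec-true (x ≟ y)

≡ᵇ-false : ∀ {x y} → x ≢ y → (x ≡ᵇ y) ≡ false
≡ᵇ-false {x} {y} = dec-false (x ≟ y)

update-same : ∀ {A : Set} {f : ℕ → A} {x a} y → x ≡ y → (f [ x ↦ a ]) y ≡ a
update-same y x≡y rewrite ≡ᵇ-true x≡y = refl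

update-other : ∀ {A : Set} {f : ℕ → A} {x a} y → x ≢ y → (f [ x ↦ a ]) y ≡ f y
update-other y x≢y rewrite ≡ᵇ-false x≢y = refl

data Name : Set where
  scalarN arrayN matrixN : ℕ → Name

Content : Name → Set
Content (scalarN _) = ℕ
Content (arrayN _)  = ℕ → ℕ
Content (matrixN _) = ℕ → ℕ → ℕ

content : State → (v : Name) → Content v
content σ (scalarN x) = scalar σ x
content σ (arrayN x)  = array σ x
content σ (matrixN x) = matrix σ x

-- An over-approximation: an array or a matrix counts as written as soon as one of its cells is
-- assigned, and a guarded statement counts as executed.
writes : Stmt → Name → Bool
writes (x ≔ _)          (scalarN y) = x ≡ᵇ y
writes (x ⟨ _ ⟩≔ _)      (arrayN y)  = x ≡ᵇ y
writes (x ⟨ _ ⟩⟨ _ ⟩≔ _)  (matrixN y) = x ≡ᵇ y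
writes (s ⨾ s′)         v           = writes s v ∨ writes s′ v
writes (when _ s)       v           = writes s v
writes (for x _ s)      (scalarN y) = (x ≡ᵇ y) ∨ writes s (scalarN y)
writes (for _ _ s)      v           = writes s v
writes _                _           = false

Agree : Stmt → State → State → Set
Agree s σ σ′ = ∀ v → writes s v ≡ false → content σ′ v ≡ content σ v

body : ℕ → Stmt → ℕ → State → State × ℕ
body x s i σ = let σ′ , t = exec s (setScalar x i σ) in σ′ , 1 + t

mutual
  agree : ∀ s σ → Agree s σ (proj₁ (exec s σ))
  agree (x ≔ e) σ (scalarN y) w rewrite w = refl
  agree (x ≔ e) σ (arrayN y) w = refl
  agree (x ≔ e) σ (matrixN y) w = refl
  agree (x ⟨ _ ⟩≔ e) σ (scalarN y) w = refl
  agree (x ⟨ _ ⟩≔ e) σ (arrayN y) w rewrite w = refl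
  agree (x ⟨ _ ⟩≔ e) σ (matrixN y) w = refl
  agree (x ⟨ _ ⟩⟨ _ ⟩≔ e) σ (scalarN y) w = refl
  agree (x ⟨ _ ⟩⟨ _ ⟩≔ e) σ (arrayN y) w = refl
  agree (x ⟨ _ ⟩⟨ _ ⟩≔ e) σ (matrixN y) w rewrite w = refl
  agree (s ⨾ s′) σ v w =
    trans (agree s′ (proj₁ (exec s σ)) v (∨-conicalʳ (writes s v) _ w))
          (agree s σ v (∨-conicalˡ (writes s v) _ w))
  agree (when e s) σ v w with eval e σ
  ... | zero  = refl
  ... | suc _ = agree s σ v w
  agree (for x e s) σ = agree-iterate x e s σ (eval e σ)

  agree-iterate : ∀ x e s σ n → Agree (for x e s) σ (proj₁ (iterate (body x s) n σ))
  agree-iterate x e s σ zero    v w = refl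
  agree-iterate x e s σ (suc n) v w =
    trans (agree-body x e s n (proj₁ (iterate (body x s) n σ)) v w)
          (agree-iterate x e s σ n v w)

  agree-body : ∀ x e s n σ → Agree (for x e s) σ (proj₁ (body x s n σ))
  agree-body x e s n σ (scalarN y) w =
    trans (agree s (setScalar x n σ) (scalarN y) (∨-conicalʳ (x ≡ᵇ y) _ w))
          (agree (x ≔ lit n) σ (scalarN y) (∨-conicalˡ (x ≡ᵇ y) _ w))
  agree-body x e s n σ (arrayN y)  w = agree s (setScalar x n σ) (arrayN y) w
  agree-body x e s n σ (matrixN y) w = agree s (setScalar x n σ) (matrixN y) w

-- A Hoare triple with a time bound for one fixed initial state; preconditions become hypotheses
-- about `σ`.
record Runs (s : Stmt) (σ : State) (T : ℕ) (Q : State → Set) : Set where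
  constructor runs
  field
    post  : Q (proj₁ (exec s σ))
    time≤ : proj₂ (exec s σ) ≤ T
open Runs public

basic : ∀ {s σ Q} → Q (proj₁ (exec s σ)) → Runs s σ (proj₂ (exec s σ)) Q
basic q = runs q ≤-refl

weaken : ∀ {s σ T P Q} → (∀ σ′ → Agree s σ σ′ → P σ′ → Q σ′) → Runs s σ T P → Runs s σ T Q
weaken {s} {σ} f r = runs (f _ (agree s σ) (post r)) (time≤ r)

infixr 3 _then_

_then_ : ∀ {s s′ σ T T′ P Q} → Runs s σ T P →
         (∀ σ′ → Agree s σ σ′ → P σ′ → Runs s′ σ′ T′ Q) →
         Runs (s ⨾ s′) σ (T + T′) Q
_then_ {s} {σ = σ} r f = runs (post r′) (+-mono-≤ (time≤ r) (time≤ r′))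
  where r′ = f _ (agree s σ) (post r)

runs-when : ∀ {e s σ T Q} →
            (eval e σ ≡ 0 → Q σ) →
            (∀ c → eval e σ ≡ suc c → Runs s σ T Q) →
            Runs (when e s) σ (1 + cost e + T) Q
runs-when {e} {s} {σ} {T} {Q} skip run = runs pst tm
  where
  pst : Q (proj₁ (exec (when e s) σ))
  pst with eval e σ
  ... | zero  = skip refl
  ... | suc c = post (run c refl)
  tm : proj₂ (exec (when e s) σ) ≤ 1 + cost e + T
  tm with eval e σ
  ... | zero  = m≤m+n (1 + cost e) T
  ... | suc c = +-monoʳ-≤ (1 + cost e) (time≤ (run c refl))

runs-for : ∀ {x e s σ N T} (Inv : ℕ → State → Set) → eval e σ ≡ N → Inv 0 σ →
           (∀ n σ′ → n < N → Agree (for x e s) σ σ′ → Inv n σ′ →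
             Runs s (setScalar x n σ′) T (Inv (suc n))) →
           Runs (for x e s) σ (1 + cost e + N * (1 + T)) (Inv N)
runs-for {x} {e} {s} {σ} {N} {T} Inv refl inv₀ step =
  runs (proj₁ (go N ≤-refl)) (+-monoʳ-≤ (1 + cost e) (proj₂ (go N ≤-refl)))
  where
  go : ∀ n → n ≤ N → Inv n (proj₁ (iterate (body x s) n σ)) ×
                     proj₂ (iterate (body x s) n σ) ≤ n * (1 + T)
  go zero    _   = inv₀ , z≤n
  go (suc n) n<N =
    post r ,
    -- `iterate` adds the time of the last iteration on the right, whereas `suc n * (1 + T)` unfolds
    -- with it on the left.
    subst (_≤ suc n * (1 + T)) (+-comm _ (proj₂ (iterate (body x s) n σ)))
      (+-mono-≤ (s≤s (time≤ r)) (proj₂ ih))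
    where
    ih = go n (≤-trans (m≤n+m n 1) n<N)
    r = step n _ n<N (agree-iterate x e s σ n) (proj₁ ih)

not-written-in-body : ∀ {x e s} v → writes (for x e s) v ≡ false → writes s v ≡ false
not-written-in-body {x} (scalarN y) w = ∨-conicalʳ (x ≡ᵇ y) _ w
not-written-in-body     (arrayN _)  w = w
not-written-in-body     (matrixN _) w = w

agree-loopVar : ∀ x e s n {σ σ′} → Agree (for x e s) σ σ′ → Agree (for x e s) σ (setScalar x n σ′)
agree-loopVar x e s n {σ′ = σ′} A (scalarN y) w =
  trans (agree (x ≔ lit n) σ′ (scalarN y) (∨-conicalˡ (x ≡ᵇ y) _ w)) (A (scalarN y) w)
agree-loopVar x e s n A (arrayN y)  w = A (arrayN y) w
agree-loopVar x e s n A (matrixN y) w = A (matrixN y) w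

-- Double loops over pairs of channels

for² : Stmt → Stmt
for² s = for 𝐢 (var #channels) (for 𝐣 (var #channels) s)

-- The numerals in the step bounds are the costs of the expressions and loop
-- headers involved.
steps² : ℕ → ℕ → ℕ
steps² K T = 2 + K * (1 + (2 + K * (1 + T)))

-- `Inv a b` describes the state after `a` full rows and `b` entries of row `a`. The body must not
-- write `#channels`, which the inner loop reads anew for each row, nor `𝐢`, by which it identifies
-- its row.
runs-for² : ∀ {s σ K T} (Inv : ℕ → ℕ → State → Set) →
            scalar σ #channels ≡ K →
            writes s (scalarN #channels) ≡ false →
            writes s (scalarN 𝐢) ≡ false →
            (∀ {a b} n σ′ → Inv a b σ′ → Inv a b (setScalar 𝐢 n σ′)) →
            (∀ {a b} n σ′ → Inv a b σ′ → Inv a b (setScalar 𝐣 n σ′)) →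
            (∀ a σ′ → Inv a K σ′ → Inv (suc a) 0 σ′) →
            Inv 0 0 σ →
            (∀ a b σ′ → a < K → b < K → scalar σ′ 𝐢 ≡ a → scalar σ′ 𝐣 ≡ b →
              Agree (for² s) σ σ′ → Inv a b σ′ → Runs s σ′ T (Inv a (suc b))) →
            Runs (for² s) σ (steps² K T) (Inv K 0)
runs-for² {s} {σ} {K} {T} Inv #≡K w# wi si sj next inv₀ step =
  runs-for (λ a → Inv a 0) #≡K inv₀ λ a σ₁ a<K A₁ I₁ →
    weaken (λ σ′ _ → next a σ′)
      (runs-for (Inv a) (trans (A₁ (scalarN #channels) w#) #≡K) (si a σ₁ I₁) λ b σ₂ b<K A₂ I₂ →
        step a b (setScalar 𝐣 b σ₂) a<K b<K (A₂ (scalarN 𝐢) wi) refl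
          (λ v w → trans
            (agree-loopVar 𝐣 (var #channels) s b A₂ v
              (not-written-in-body {𝐢} {var #channels} v w))
            (agree-loopVar 𝐢 (var #channels) (for 𝐣 (var #channels) s) a A₁ v w))
          (sj b σ₂ I₂))

Before : ℕ → ℕ → ℕ → ℕ → Set
Before a b a′ b′ = a′ < a ⊎ (a′ ≡ a × b′ < b)

-- A pass changes only its own entry of matrix `x`, so the entries earlier in the row-major order of
-- `Before` keep their property; `P` does not see the state and cannot be spoilt by other writes.
runs-fill : ∀ x {s σ K T} (P : ℕ → ℕ → ℕ → Set) →
            scalar σ #channels ≡ K →
            writes s (scalarN #channels) ≡ false →
            writes s (scalarN 𝐢) ≡ false →
            (∀ a b σ′ → a < K → b < K → scalar σ′ 𝐢 ≡ a → scalar σ′ 𝐣 ≡ b → Agree (for² s) σ σ′ →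
              Runs s σ′ T λ σ″ → P a b (matrix σ″ x a b) ×
                (∀ a′ b′ → a ≢ a′ ⊎ b ≢ b′ → matrix σ″ x a′ b′ ≡ matrix σ′ x a′ b′)) →
            Runs (for² s) σ (steps² K T) (λ σ′ → ∀ a b → a < K → b < K → P a b (matrix σ′ x a b))
runs-fill x {s} {σ} {K} P #≡K w# wi step =
  weaken (λ _ _ inv a b a<K b<K → inv a b b<K (inj₁ a<K))
    (runs-for² Inv #≡K w# wi (λ _ _ I → I) (λ _ _ I → I) next
      (λ _ _ _ → λ { (inj₁ ()) ; (inj₂ (_ , ())) })
      λ a b σ′ a<K b<K i≡ j≡ A I → weaken (λ σ″ _ → extend a b σ′ σ″ I) (step a b σ′ a<K b<K i≡ j≡ A))
  where
  Inv : ℕ → ℕ → State → Set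
  Inv a b σ′ = ∀ a′ b′ → b′ < K → Before a b a′ b′ → P a′ b′ (matrix σ′ x a′ b′)
  next : ∀ a σ′ → Inv a K σ′ → Inv (suc a) 0 σ′
  next a σ′ I a′ b′ b′<K (inj₁ a′<1+a) with m<1+n⇒m<n∨m≡n a′<1+a
  ... | inj₁ a′<a = I a′ b′ b′<K (inj₁ a′<a)
  ... | inj₂ a′≡a = I a′ b′ b′<K (inj₂ (a′≡a , b′<K))
  extend : ∀ a b σ′ σ″ → Inv a b σ′ →
           P a b (matrix σ″ x a b) ×
             (∀ a′ b′ → a ≢ a′ ⊎ b ≢ b′ → matrix σ″ x a′ b′ ≡ matrix σ′ x a′ b′) →
           Inv a (suc b) σ″
  extend a b σ′ σ″ I (p , same) a′ b′ b′<K before with a ≟ a′ | b ≟ b′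
  ... | yes refl | yes refl = p
  ... | no a≢a′  | _        = subst (P a′ b′) (sym (same a′ b′ (inj₁ a≢a′))) (I a′ b′ b′<K (case before))
    where
    case : Before a (suc b) a′ b′ → Before a b a′ b′
    case (inj₁ p)       = inj₁ p
    case (inj₂ (p , _)) = contradiction (sym p) a≢a′
  ... | yes refl | no b≢b′  = subst (P a b′) (sym (same a b′ (inj₂ b≢b′))) (I a b′ b′<K (case before))
    where
    case : Before a (suc b) a b′ → Before a b a b′
    case (inj₁ p)         = inj₁ p
    case (inj₂ (p , q)) with m<1+n⇒m<n∨m≡n q
    ... | inj₁ q′ = inj₂ (p , q′)
    ... | inj₂ q′ = contradiction (sym q′) b≢b′

sumTo : ℕ → (ℕ → ℕ) → ℕ
sumTo n f = sum {n} (f ∘ toℕ)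

-- `sum` unfolds at the first summand, while a loop adds the last one.
sumTo-suc : ∀ n f → sumTo (suc n) f ≡ sumTo n f + f n
sumTo-suc n f = trans (sum-init-last {n} (f ∘ toℕ))
  (cong₂ _+_ (sum-cong-≗ {n} (cong f ∘ Fin.toℕ-inject₁)) (cong f (Fin.toℕ-fromℕ n)))

-- The machine has no negation; inequality is tested by comparing the value of an equality test with
-- 0.
runs-unless-≡ : ∀ {e₁ e₂ s σ T Q} →
                (eval e₁ σ ≡ eval e₂ σ → Q σ) → (eval e₁ σ ≢ eval e₂ σ → Runs s σ T Q) →
                Runs (when (op eq (op eq e₁ e₂) (lit 0)) s) σ
                     (1 + (1 + (1 + (cost e₁ + cost e₂) + 1)) + T) Q
runs-unless-≡ {e₁} {e₂} {σ = σ} skip run = runs-when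
  (λ z → skip (zero⇒≡ z))
  (λ _ nz → run (λ x≡y → ≢zero nz x≡y))
  where
  x = eval e₁ σ
  y = eval e₂ σ
  zero⇒≡ : apply eq (apply eq x y) 0 ≡ 0 → x ≡ y
  zero⇒≡ z with x ≟ y
  ... | yes x≡y = x≡y
  ... | no  x≢y rewrite ≡ᵇ-false x≢y with () ← z
  ≢zero : ∀ {c} → apply eq (apply eq x y) 0 ≡ suc c → x ≢ y
  ≢zero nz x≡y rewrite ≡ᵇ-true x≡y with () ← nz

-- Enumerating the orders

-- This is the quotient of `t` by `n !`, obtained as in the program by dividing by 1, 2, ..., `n` in
-- turn.
remainingCode : ℕ → ℕ → ℕ
remainingCode t zero    = t
remainingCode t (suc n) = remainingCode t n / suc n

digit : ℕ → ∀ n → Fin (suc n)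
digit t n = remainingCode t n mod suc n

insertLast : ∀ {n} → Permutation′ n → Permutation′ (suc n)
insertLast {n} = insert (fromℕ n) (fromℕ n)

-- The transposition acts first, on places: the place given by the digit is sent to the largest
-- position, and place `n`, if different, takes over the position that this place had. This is the
-- effect of the two assignments to `ordcur`.
shuffle : ℕ → ∀ n → Permutation′ n
shuffle t zero    = Permutation.id
shuffle t (suc n) = transpose (digit t n) (fromℕ n) ∘ₚ insertLast (shuffle t n)

toℕ-punchIn-last : ∀ n (x : Fin n) → toℕ (punchIn (fromℕ n) x) ≡ toℕ x
toℕ-punchIn-last (suc n) Fin.zero    = refl
toℕ-punchIn-last (suc n) (Fin.suc x) = cong suc (toℕ-punchIn-last n x)

insertLast-last : ∀ {n} (π : Permutation′ n) → insertLast π ⟨$⟩ʳ fromℕ n ≡ fromℕ n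
insertLast-last {n} π with fromℕ n Fin.≟ fromℕ n
... | yes _  = refl
... | no neq = contradiction refl neq

insertLast-other : ∀ {n} (π : Permutation′ n) {x} → x ≢ fromℕ n →
                   ∃[ y ] toℕ y ≡ toℕ x × toℕ (insertLast π ⟨$⟩ʳ x) ≡ toℕ (π ⟨$⟩ʳ y)
insertLast-other {n} π {x} x≢last with fromℕ n Fin.≟ x
... | yes last≡x = contradiction (sym last≡x) x≢last
... | no  last≢x =
  punchOut last≢x ,
  trans (sym (toℕ-punchIn-last n _)) (cong toℕ (Fin.punchIn-punchOut last≢x)) ,
  toℕ-punchIn-last n _

-- Permutations are compared by their values only, as the records also contain inverses and proofs.
insertLast-cong : ∀ {n} {π ρ : Permutation′ n} → (∀ x → π ⟨$⟩ʳ x ≡ ρ ⟨$⟩ʳ x) →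
                  ∀ x → insertLast π ⟨$⟩ʳ x ≡ insertLast ρ ⟨$⟩ʳ x
insertLast-cong {n} π≈ρ x with fromℕ n Fin.≟ x
... | yes _ = refl
... | no _  = cong (punchIn (fromℕ n)) (π≈ρ _)

transpose-first : ∀ {n} {u v w : Fin n} → w ≡ u → Components.transpose u v w ≡ v
transpose-first {u = u} {w = w} w≡u rewrite dec-true (w Fin.≟ u) w≡u = refl

transpose-second : ∀ {n} {u v w : Fin n} → w ≢ u → w ≡ v → Components.transpose u v w ≡ u
transpose-second {u = u} {v} {w} w≢u w≡v
  rewrite dec-false (w Fin.≟ u) w≢u | dec-true (w Fin.≟ v) w≡v = refl

transpose-other : ∀ {n} {u v w : Fin n} → w ≢ u → w ≢ v → Components.transpose u v w ≡ w
transpose-other {u = u} {v} {w} w≢u w≢v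
  rewrite dec-false (w Fin.≟ u) w≢u | dec-false (w Fin.≟ v) w≢v = refl

-- `transpose-inverse` undoes a transposition by the one with swapped arguments; symmetry makes
-- every transposition an involution.
transpose-comm : ∀ {n} (u v w : Fin n) → Components.transpose u v w ≡ Components.transpose v u w
transpose-comm u v w = go (w Fin.≟ u) (w Fin.≟ v)
  where
  go : Dec (w ≡ u) → Dec (w ≡ v) → Components.transpose u v w ≡ Components.transpose v u w
  go (yes w≡u) (yes w≡v) = trans (transpose-first w≡u)
    (trans (sym w≡v) (trans w≡u (sym (transpose-first w≡v))))
  go (yes w≡u) (no w≢v)  = trans (transpose-first w≡u) (sym (transpose-second w≢v w≡u))
  go (no w≢u)  (yes w≡v) = trans (transpose-second w≢u w≡v) (sym (transpose-first w≡v))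
  go (no w≢u)  (no w≢v)  = trans (transpose-other w≢u w≢v) (sym (transpose-other w≢v w≢u))

Stores : ∀ {n} → (ℕ → ℕ) → Permutation′ n → Set
Stores g π = ∀ x → g (toℕ x) ≡ suc (toℕ (π ⟨$⟩ʳ x))

shuffle-step : ∀ {n} (π : Permutation′ n) (d : Fin (suc n)) {g} → Stores g π →
               Stores ((g [ n ↦ g (toℕ d) ]) [ toℕ d ↦ suc n ])
                      (transpose d (fromℕ n) ∘ₚ insertLast π)
shuffle-step {n} π d {g} stores x = go (x Fin.≟ d) (x Fin.≟ fromℕ n)
  where
  g′ = g [ n ↦ g (toℕ d) ]
  moved : ∀ {z} → Components.transpose d (fromℕ n) x ≡ z →
          suc (toℕ (insertLast π ⟨$⟩ʳ z)) ≡
          suc (toℕ (insertLast π ⟨$⟩ʳ Components.transpose d (fromℕ n) x))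
  moved p = cong (suc ∘ toℕ ∘ (insertLast π ⟨$⟩ʳ_)) (sym p)
  other : ∀ {z} → z ≢ fromℕ n → g (toℕ z) ≡ suc (toℕ (insertLast π ⟨$⟩ʳ z))
  other z≢last = let y , y≡z , E≡π = insertLast-other π z≢last in
    trans (cong g (sym y≡z)) (trans (stores y) (cong suc (sym E≡π)))
  go : Dec (x ≡ d) → Dec (x ≡ fromℕ n) →
       (g′ [ toℕ d ↦ suc n ]) (toℕ x) ≡
       suc (toℕ (insertLast π ⟨$⟩ʳ Components.transpose d (fromℕ n) x))
  -- This includes `d = n`, where the first assignment copies a cell not yet set; the second
  -- overwrites it.
  go (yes x≡d) _ = trans (update-same {f = g′} (toℕ x) (cong toℕ (sym x≡d)))
    (trans (cong suc (sym (trans (cong toℕ (insertLast-last π)) (Fin.toℕ-fromℕ n))))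
           (moved (transpose-first x≡d)))
  go (no x≢d) (yes x≡last) = trans (update-other {f = g′} (toℕ x) (x≢d ∘ Fin.toℕ-injective ∘ sym))
    (trans (update-same {f = g} (toℕ x) (trans (sym (Fin.toℕ-fromℕ n)) (cong toℕ (sym x≡last))))
    (trans (other (λ d≡last → x≢d (trans x≡last (sym d≡last))))
           (moved (transpose-second x≢d x≡last))))
  go (no x≢d) (no x≢last) = trans (update-other {f = g′} (toℕ x) (x≢d ∘ Fin.toℕ-injective ∘ sym))
    (trans (update-other {f = g} (toℕ x)
      (λ p → x≢last (Fin.toℕ-injective (trans (sym p) (sym (Fin.toℕ-fromℕ n))))))
    (trans (other x≢last) (moved (transpose-other x≢d x≢last))))

-- The first n digits of t + n! q are those of t, and q encodes the later ones; the
-- induction needs them to be arbitrary.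
shuffle-onto : ∀ n (π : Permutation′ n) →
               ∃[ t ] t < n ! × (∀ q → remainingCode (t + n ! * q) n ≡ q ×
                 (∀ x → shuffle (t + n ! * q) n ⟨$⟩ʳ x ≡ π ⟨$⟩ʳ x))
shuffle-onto zero    π = 0 , ≤-refl , λ q → +-identityʳ q , λ ()
shuffle-onto (suc n) π = t′ , t′<[1+n]! , λ q → rest q , perm q
  where
  open ≡-Reasoning
  last = fromℕ n
  d = π ⟨$⟩ˡ last
  -- `ρ` undoes the exchange of the last round: it fixes `last`, so that removing `last` leaves a
  -- permutation of `n` places.
  ρ = transpose d last ∘ₚ π
  ρ-last : ρ ⟨$⟩ʳ last ≡ last
  ρ-last = trans
    (cong (π ⟨$⟩ʳ_) (trans (transpose-comm d last last) (transpose-first {u = last} refl)))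
    (inverseʳ π)
  π′ = remove last ρ
  ih = shuffle-onto n π′
  t = proj₁ ih
  -- The digit of radix `n + 1` has place value `n !`.
  t′ = t + n ! * toℕ d
  t′<[1+n]! : t′ < suc n !
  t′<[1+n]! = <-≤-trans (+-monoˡ-< (n ! * toℕ d) (proj₁ (proj₂ ih)))
    (≤-trans (≤-reflexive (sym (*-suc (n !) (toℕ d))))
      (≤-trans (*-monoʳ-≤ (n !) (Fin.toℕ<n d)) (≤-reflexive (*-comm (n !) (suc n)))))
  -- What follows the first `n + 1` digits is `q`; what follows the first `n` is
  -- `toℕ d + q * suc n`, and at this value the induction hypothesis is used.
  split : ∀ q → t′ + suc n ! * q ≡ t + n ! * (toℕ d + q * suc n)
  split q = begin
    t + n ! * toℕ d + suc n * n ! * q      ≡⟨ +-assoc t _ _ ⟩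
    t + (n ! * toℕ d + suc n * n ! * q)    ≡⟨ cong (λ z → t + (n ! * toℕ d + z * q)) (*-comm (suc n) (n !)) ⟩
    t + (n ! * toℕ d + n ! * suc n * q)    ≡⟨ cong (λ z → t + (n ! * toℕ d + z)) (*-assoc (n !) (suc n) q) ⟩
    t + (n ! * toℕ d + n ! * (suc n * q))  ≡⟨ cong (λ z → t + (n ! * toℕ d + n ! * z)) (*-comm (suc n) q) ⟩
    t + (n ! * toℕ d + n ! * (q * suc n))  ≡⟨ cong (t +_) (*-distribˡ-+ (n !) (toℕ d) (q * suc n)) ⟨
    t + n ! * (toℕ d + q * suc n)          ∎
  rest-n : ∀ q → remainingCode (t′ + suc n ! * q) n ≡ toℕ d + q * suc n
  rest-n q = trans (cong (λ z → remainingCode z n) (split q))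
    (proj₁ (proj₂ (proj₂ ih) (toℕ d + q * suc n)))
  rest : ∀ q → remainingCode (t′ + suc n ! * q) (suc n) ≡ q
  rest q = begin
    remainingCode (t′ + suc n ! * q) n / suc n     ≡⟨ cong (_/ suc n) (rest-n q) ⟩
    (toℕ d + q * suc n) / suc n                    ≡⟨ +-distrib-/-∣ʳ (toℕ d) (n∣m*n q) ⟩
    toℕ d / suc n + q * suc n / suc n              ≡⟨ cong₂ _+_ (m<n⇒m/n≡0 (Fin.toℕ<n d)) (m*n/n≡m q (suc n)) ⟩
    q                                              ∎
  digit-d : ∀ q → digit (t′ + suc n ! * q) n ≡ d
  digit-d q = Fin.toℕ-injective (begin
    toℕ (digit (t′ + suc n ! * q) n)               ≡⟨ Fin.toℕ-fromℕ< _ ⟩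
    remainingCode (t′ + suc n ! * q) n % suc n     ≡⟨ cong (_% suc n) (rest-n q) ⟩
    (toℕ d + q * suc n) % suc n                    ≡⟨ [m+kn]%n≡m%n (toℕ d) q (suc n) ⟩
    toℕ d % suc n                                  ≡⟨ m<n⇒m%n≡m (Fin.toℕ<n d) ⟩
    toℕ d                                          ∎)
  insertLast-π′ : ∀ x → insertLast π′ ⟨$⟩ʳ x ≡ ρ ⟨$⟩ʳ x
  insertLast-π′ x = trans (cong (λ z → insert last z π′ ⟨$⟩ʳ x) (sym ρ-last)) (insert-remove last ρ x)
  perm : ∀ q x → shuffle (t′ + suc n ! * q) (suc n) ⟨$⟩ʳ x ≡ π ⟨$⟩ʳ x
  perm q x = begin
    insertLast (shuffle (t′ + suc n ! * q) n) ⟨$⟩ʳ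
        Components.transpose (digit (t′ + suc n ! * q) n) last x
      ≡⟨ insertLast-cong {π = shuffle (t′ + suc n ! * q) n} {π′} (λ y → trans
           (cong (λ z → shuffle z n ⟨$⟩ʳ y) (split q))
           (proj₂ (proj₂ (proj₂ ih) (toℕ d + q * suc n)) y)) _ ⟩
    insertLast π′ ⟨$⟩ʳ Components.transpose (digit (t′ + suc n ! * q) n) last x
      ≡⟨ insertLast-π′ _ ⟩
    ρ ⟨$⟩ʳ Components.transpose (digit (t′ + suc n ! * q) n) last x
      ≡⟨ cong (λ z → ρ ⟨$⟩ʳ Components.transpose z last x) (digit-d q) ⟩
    ρ ⟨$⟩ʳ Components.transpose d last x
      ≡⟨ cong (π ⟨$⟩ʳ_) (trans
           (cong (Components.transpose d last) (transpose-comm d last x))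
           (Components.transpose-inverse d last)) ⟩
    π ⟨$⟩ʳ x ∎

-- The stages of the algorithm

infixr 3 _next_

-- The first statement needs no postcondition: its final state is computed, and the reasoning
-- continues from there with its exact cost.
_next_ : ∀ s {s′ σ T Q} → Runs s′ (proj₁ (exec s σ)) T Q →
         Runs (s ⨾ s′) σ (proj₂ (exec s σ) + T) Q
_next_ s {σ = σ} r = basic {Q = λ σ′ → σ′ ≡ proj₁ (exec s σ)} refl then λ { _ _ refl → r }

update²-same : ∀ {f : ℕ → ℕ → ℕ} {p q v a b} → p ≡ a → q ≡ b →
               (f [ p ↦ f p [ q ↦ v ] ]) a b ≡ v
update²-same {f} {p} {q} {v} {a} {b} p≡a q≡b =
  trans (cong (λ h → h b) (update-same {f = f} a p≡a)) (update-same {f = f p} b q≡b)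

update²-other : ∀ {f : ℕ → ℕ → ℕ} {p q v a b} → p ≢ a ⊎ q ≢ b →
                (f [ p ↦ f p [ q ↦ v ] ]) a b ≡ f a b
update²-other {f} {p} {q} {v} {a} {b} (inj₁ p≢a) = cong (λ h → h b) (update-other {f = f} a p≢a)
update²-other {f} {p} {q} {v} {a} {b} (inj₂ q≢b) with p ≟ a
... | yes refl = trans (cong (λ h → h b) (update-same {f = f} p refl)) (update-other {f = f p} b q≢b)
... | no p≢a   = cong (λ h → h b) (update-other {f = f} a p≢a)

-- A x and B x are the channels of the source and of the target of the x-th edge.
edgesBetween : (A B : ℕ → ℕ) → ℕ → ℕ → ℕ → ℕ
edgesBetween A B n a b = sumTo n λ x → fromBool ((A x ≡ᵇ a) ∧ (B x ≡ᵇ b))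

fromBool-both : ∀ {x y a b} → x ≡ a → y ≡ b → fromBool ((x ≡ᵇ a) ∧ (y ≡ᵇ b)) ≡ 1
fromBool-both x≡a y≡b rewrite ≡ᵇ-true x≡a | ≡ᵇ-true y≡b = refl

fromBool-not-both : ∀ {x y a b} → x ≢ a ⊎ y ≢ b → fromBool ((x ≡ᵇ a) ∧ (y ≡ᵇ b)) ≡ 0
fromBool-not-both (inj₁ x≢a) rewrite ≡ᵇ-false x≢a = refl
fromBool-not-both {x} {a = a} (inj₂ y≢b) rewrite ≡ᵇ-false y≢b with x ≡ᵇ a
... | true  = refl
... | false = refl

steps-countCrossEdges : ℕ → ℕ → ℕ
steps-countCrossEdges K E = steps² K 4 + (2 + E * (1 + (4 + (4 + 14))))

-- The restriction to distinct channels matters: the program skips edges inside a channel, so its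
-- diagonal stays 0, while `edgesBetween` counts these edges there.
runs-countCrossEdges :
  ∀ {σ K E} → scalar σ #channels ≡ K → scalar σ #edges ≡ E →
  Runs countCrossEdges σ (steps-countCrossEdges K E) λ σ′ → ∀ a b → a < K → b < K → a ≢ b →
    matrix σ′ 𝐦 a b ≡ edgesBetween (array σ chan ∘ array σ src) (array σ chan ∘ array σ tgt) E a b
runs-countCrossEdges {σ} {K} {E} #≡K #≡E =
  runs-fill 𝐦 (λ _ _ v → v ≡ 0) #≡K refl refl
    (λ { a b σ′ _ _ refl refl _ → basic
         ( update²-same {f = matrix σ′ 𝐦} {a = a} {b} refl refl
         , λ a′ b′ neq → update²-other {f = matrix σ′ 𝐦} {a = a′} {b′} neq) })
  then λ σ₁ A₁ zeros →
  runs-for Inv (trans (A₁ (scalarN #edges) refl) #≡E) (λ a b a<K b<K _ → zeros a b a<K b<K)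
    λ n σ₂ n<E A₂ I →
      (𝐚 ≔ chan ⟨ src ⟨ var 𝐞 ⟩ ⟩) next
      (𝐛 ≔ chan ⟨ tgt ⟨ var 𝐞 ⟩ ⟩) next
      let A≡ : array σ₂ chan (array σ₂ src n) ≡ A n
          A≡ = trans
            (cong (λ f → f (array σ₂ src n)) (trans (A₂ (arrayN chan) refl) (A₁ (arrayN chan) refl)))
            (cong (λ f → array σ chan (f n)) (trans (A₂ (arrayN src) refl) (A₁ (arrayN src) refl)))
          B≡ : array σ₂ chan (array σ₂ tgt n) ≡ B n
          B≡ = trans
            (cong (λ f → f (array σ₂ tgt n)) (trans (A₂ (arrayN chan) refl) (A₁ (arrayN chan) refl)))
            (cong (λ f → array σ chan (f n)) (trans (A₂ (arrayN tgt) refl) (A₁ (arrayN tgt) refl)))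
          unchanged : ∀ {a b v} → A n ≢ a ⊎ B n ≢ b →
                      v ≡ edgesBetween A B n a b → v ≡ edgesBetween A B (suc n) a b
          unchanged {a} {b} neq v≡ = trans v≡ (sym (trans (sumTo-suc n (summand a b))
            (trans (cong (edgesBetween A B n a b +_) (fromBool-not-both neq)) (+-identityʳ _))))
      in runs-unless-≡ {e₁ = var 𝐚} {e₂ = var 𝐛}
        -- A skipped edge has both ends in one channel, so it counts for no pair of distinct
        -- channels.
        (λ a≡b a b a<K b<K a≢b →
          unchanged (distinct (trans (sym A≡) (trans a≡b B≡)) a≢b) (I a b a<K b<K a≢b))
        (λ _ → basic λ a b a<K b<K a≢b → increment σ₂ n A≡ B≡ unchanged a b (I a b a<K b<K a≢b))
  where
  A = array σ chan ∘ array σ src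
  B = array σ chan ∘ array σ tgt
  summand : ℕ → ℕ → ℕ → ℕ
  summand a b x = fromBool ((A x ≡ᵇ a) ∧ (B x ≡ᵇ b))
  Inv : ℕ → State → Set
  Inv n σ′ = ∀ a b → a < K → b < K → a ≢ b → matrix σ′ 𝐦 a b ≡ edgesBetween A B n a b
  distinct : ∀ {x y a b : ℕ} → x ≡ y → a ≢ b → x ≢ a ⊎ y ≢ b
  distinct {x} {y} {a} {b} x≡y a≢b with x ≟ a
  ... | yes x≡a = inj₂ λ y≡b → a≢b (trans (sym x≡a) (trans x≡y y≡b))
  ... | no x≢a  = inj₁ x≢a
  increment : ∀ σ₂ n {p q} → p ≡ A n → q ≡ B n →
    (∀ {a b v} → A n ≢ a ⊎ B n ≢ b →
      v ≡ edgesBetween A B n a b → v ≡ edgesBetween A B (suc n) a b) →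
    ∀ a b → matrix σ₂ 𝐦 a b ≡ edgesBetween A B n a b →
    (matrix σ₂ 𝐦 [ p ↦ matrix σ₂ 𝐦 p [ q ↦ matrix σ₂ 𝐦 p q + 1 ] ]) a b ≡
      edgesBetween A B (suc n) a b
  increment σ₂ n {p} {q} refl refl unchanged a b I with p ≟ a | q ≟ b
  ... | yes refl | yes refl = trans (update²-same {f = matrix σ₂ 𝐦} {a = a} {b} refl refl)
    (sym (trans (sumTo-suc n (summand a b))
      (cong₂ _+_ (sym I) (fromBool-both {A n} {B n} refl refl))))
  ... | no p≢a   | _        = trans
    (update²-other {f = matrix σ₂ 𝐦} {p} {q} {matrix σ₂ 𝐦 p q + 1} (inj₁ p≢a))
    (unchanged (inj₁ p≢a) I)
  ... | yes _    | no q≢b   = trans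
    (update²-other {f = matrix σ₂ 𝐦} {p} {q} {matrix σ₂ 𝐦 p q + 1} (inj₂ q≢b))
    (unchanged (inj₂ q≢b) I)

steps-countOrders : ℕ → ℕ
steps-countOrders K = 2 + (2 + K * (1 + 6))

runs-countOrders : ∀ {σ K} → scalar σ #channels ≡ K →
                   Runs countOrders σ (steps-countOrders K) λ σ′ → scalar σ′ #orders ≡ K !
runs-countOrders #≡K = (#orders ≔ lit 1) next
  runs-for (λ n σ′ → scalar σ′ #orders ≡ n !) #≡K refl λ n σ′ _ _ I →
    basic (trans (cong₂ _*_ I (+-comm n 1)) (*-comm (n !) (suc n)))

steps-decodeOrder : ℕ → ℕ
steps-decodeOrder K = 2 + (2 + K * (1 + (6 + (6 + (4 + 5)))))

-- `n + 1` does not reduce to a successor, which `apply quo` needs to choose its case.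
apply-quo-suc : ∀ x n → apply quo x (n + 1) ≡ x / suc n
apply-quo-suc x n rewrite +-comm n 1 = refl

apply-rem-suc : ∀ x n → apply rem x (n + 1) ≡ x % suc n
apply-rem-suc x n rewrite +-comm n 1 = refl

runs-decodeOrder : ∀ {σ K} → scalar σ #channels ≡ K →
  Runs decodeOrder σ (steps-decodeOrder K) λ σ′ → Stores (array σ′ ordcur) (shuffle (scalar σ 𝐭) K)
runs-decodeOrder {σ} {K} #≡K = (code ≔ var 𝐭) next
  weaken (λ _ _ → proj₂)
    (runs-for Inv #≡K (refl , λ ()) λ { n σ′ _ _ (code≡ , stores) →
      (𝐝 ≔ op rem (var code) (op add (var 𝐢) (lit 1))) next
      (code ≔ op quo (var code) (op add (var 𝐢) (lit 1))) next
      (ordcur ⟨ var 𝐢 ⟩≔ ordcur ⟨ var 𝐝 ⟩) next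
      basic
        ( trans (apply-quo-suc (scalar σ′ code) n) (cong (_/ suc n) code≡)
        , λ x → trans
            (cong₂ (λ d v → (((array σ′ ordcur) [ n ↦ array σ′ ordcur d ]) [ d ↦ v ]) (toℕ x))
              (trans (apply-rem-suc (scalar σ′ code) n)
                (trans (cong (_% suc n) code≡) (sym (Fin.toℕ-fromℕ< (m%n<n (remainingCode t n) (suc n))))))
              (+-comm n 1))
            (shuffle-step (shuffle t n) (digit t n) {array σ′ ordcur} stores x) ) })
  where
  t = scalar σ 𝐭
  Inv : ℕ → State → Set
  Inv n σ′ = scalar σ′ code ≡ remainingCode t n × Stores (array σ′ ordcur) (shuffle t n)

runs-computeK : ∀ {σ K} → scalar σ #channels ≡ K →
  Runs computeK σ (steps² K 16) λ σ′ → ∀ a b → a < K → b < K → a ≢ b →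
    matrix σ′ 𝐤 a b ≡ ∣ array σ ordcur a - array σ ordcur b ∣ ∸ 1
runs-computeK {σ} {K} #≡K =
  -- `k` is not assigned on the diagonal, hence the premise `a ≢ b` inside the property of an entry.
  runs-fill 𝐤 (λ a b v → a ≢ b → v ≡ ∣ array σ ordcur a - array σ ordcur b ∣ ∸ 1) #≡K refl refl
    λ { a b σ′ _ _ refl refl A →
      runs-unless-≡ {e₁ = var 𝐢} {e₂ = var 𝐣}
        (λ a≡b → (λ a≢b → contradiction a≡b a≢b) , λ _ _ _ → refl)
        (λ _ → basic
          ( (λ _ → trans (update²-same {f = matrix σ′ 𝐤} {a = a} {b} refl refl)
                         (cong (λ f → ∣ f a - f b ∣ ∸ 1) (A (arrayN ordcur) refl)))
          , λ a′ b′ neq → update²-other {f = matrix σ′ 𝐤} {a = a′} {b′} neq)) }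

-- Costs of orders as double sums

offDiagonal : (ℕ → ℕ → ℕ) → ℕ → ℕ → ℕ
offDiagonal f a b = if a ≡ᵇ b then 0 else f a b

offDiagonal-≡ : ∀ f {a b} → a ≡ b → offDiagonal f a b ≡ 0
offDiagonal-≡ f a≡b rewrite ≡ᵇ-true a≡b = refl

offDiagonal-≢ : ∀ f {a b} → a ≢ b → offDiagonal f a b ≡ f a b
offDiagonal-≢ f a≢b rewrite ≡ᵇ-false a≢b = refl

runs-computeθ : ∀ {σ K} → scalar σ #channels ≡ K →
  Runs computeθ σ (2 + steps² K 16) λ σ′ → scalar σ′ θcur ≡
    sumTo K λ a → sumTo K (offDiagonal (λ a b → matrix σ 𝐦 a b * matrix σ 𝐤 a b) a)
runs-computeθ {σ} {K} #≡K = (θcur ≔ lit 0) next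
  weaken (λ _ _ I → trans I (+-identityʳ _))
    (runs-for² Inv #≡K refl refl (λ _ _ I → I) (λ _ _ I → I)
      (λ a _ I → trans I (sym (trans (+-identityʳ _) (sumTo-suc a row)))) refl
      λ { a b σ′ _ _ refl refl A I →
        let extend : ∀ {v} → v ≡ entry a b → scalar σ′ θcur + v ≡ sumTo a row + sumTo (suc b) (entry a)
            extend v≡ = trans (cong₂ _+_ I v≡)
              (trans (+-assoc (sumTo a row) _ _) (cong (sumTo a row +_) (sym (sumTo-suc b (entry a)))))
        in runs-unless-≡ {e₁ = var 𝐢} {e₂ = var 𝐣}
          (λ a≡b → trans (sym (+-identityʳ _)) (extend (sym (offDiagonal-≡ weight a≡b))))
          (λ a≢b → basic (extend (trans
            (cong₂ (λ f g → f a b * g a b) (A (matrixN 𝐦) refl) (A (matrixN 𝐤) refl))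
            (sym (offDiagonal-≢ weight a≢b))))) })
  where
  weight : ℕ → ℕ → ℕ
  weight a b = matrix σ 𝐦 a b * matrix σ 𝐤 a b
  entry = offDiagonal weight
  row : ℕ → ℕ
  row a = sumTo K (entry a)
  Inv : ℕ → ℕ → State → Set
  Inv a b σ′ = scalar σ′ θcur ≡ sumTo a row + sumTo b (entry a)

orderCost : ∀ {K L} → (ℕ → ℕ → ℕ) → Permutation K L → ℕ
orderCost M π = sum λ x → sum λ y →
  if does (x Fin.≟ y) then 0
  else M (toℕ x) (toℕ y) * (∣ toℕ (π ⟨$⟩ʳ x) - toℕ (π ⟨$⟩ʳ y) ∣ ∸ 1)

offDiagonal-orderCost : ∀ {K} M (π : Permutation′ K) {g w} → Stores g π →
  (∀ a b → a < K → b < K → a ≢ b → w a b ≡ M a b * (∣ g a - g b ∣ ∸ 1)) →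
  sumTo K (λ a → sumTo K (offDiagonal w a)) ≡ orderCost M π
offDiagonal-orderCost {K} M π {g} {w} stores w≡ = sum-cong-≗ λ x → sum-cong-≗ λ y → entry x y
  where
  entry : ∀ x y → offDiagonal w (toℕ x) (toℕ y) ≡
    (if does (x Fin.≟ y) then 0
     else M (toℕ x) (toℕ y) * (∣ toℕ (π ⟨$⟩ʳ x) - toℕ (π ⟨$⟩ʳ y) ∣ ∸ 1))
  entry x y with x Fin.≟ y
  ... | yes x≡y = offDiagonal-≡ w (cong toℕ x≡y)
  ... | no x≢y  = trans (offDiagonal-≢ w (x≢y ∘ Fin.toℕ-injective))
    (trans (w≡ (toℕ x) (toℕ y) (Fin.toℕ<n x) (Fin.toℕ<n y) (x≢y ∘ Fin.toℕ-injective))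
           -- `∣ suc p - suc q ∣` reduces to `∣ p - q ∣`, which takes the positions in memory to
           -- those in `Fin`.
           (cong₂ (λ p q → M (toℕ x) (toℕ y) * (∣ p - q ∣ ∸ 1)) (stores x) (stores y)))

better? : Expr
better? = op or (op eq (var finite) (lit 0)) (op lt (var θcur) (var θm))

¬better? : ∀ σ → eval better? σ ≡ 0 → scalar σ finite ≢ 0 × scalar σ θm ≤ scalar σ θcur
¬better? σ z with scalar σ finite ≟ 0 | scalar σ θcur <? scalar σ θm
... | yes p | _     rewrite ≡ᵇ-true p with () ← z
... | no p  | yes q rewrite ≡ᵇ-false p | dec-true (scalar σ θcur <? scalar σ θm) q with () ← z
... | no p  | no q  = p , ≮⇒≥ q

better?-true : ∀ σ {c} → eval better? σ ≡ suc c → scalar σ finite ≡ 0 ⊎ scalar σ θcur < scalar σ θm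
better?-true σ nz with scalar σ finite ≟ 0 | scalar σ θcur <? scalar σ θm
... | yes p | _     = inj₁ p
... | no _  | yes q = inj₂ q
... | no p  | no q  rewrite ≡ᵇ-false p | dec-false (scalar σ θcur <? scalar σ θm) q with () ← nz

steps-keepBest : ℕ → ℕ
steps-keepBest K = 8 + (2 + (2 + (2 + K * (1 + 4))))

steps-tryOrder : ℕ → ℕ
steps-tryOrder K = steps-decodeOrder K + (steps² K 16 + ((2 + steps² K 16) + steps-keepBest K))

tryOrder : Stmt
tryOrder = decodeOrder ⨾ computeK ⨾ computeθ ⨾ keepBest

module _ {K : ℕ} (M : ℕ → ℕ → ℕ) where

  record Minimum (n : ℕ) (σ : State) : Set where
    field
      isFinite : scalar σ finite ≡ 1
      index    : ℕ
      θm-≡     : scalar σ θm ≡ orderCost M (shuffle index K)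
      ordm-≡   : Stores (array σ ordm) (shuffle index K)
      minimal  : ∀ t → t < n → scalar σ θm ≤ orderCost M (shuffle t K)
  open Minimum

  -- Before any order is tried, `θm` stands for infinity and neither it nor `ordm` holds a
  -- meaningful value, so the invariant has a case of its own for `n ≡ 0`.
  Best : ℕ → State → Set
  Best n σ = (n ≡ 0 × scalar σ finite ≡ 0) ⊎ Minimum n σ

  runs-keepBest : ∀ {σ n} → scalar σ #channels ≡ K → Best n σ →
    scalar σ θcur ≡ orderCost M (shuffle n K) → Stores (array σ ordcur) (shuffle n K) →
    Runs keepBest σ (steps-keepBest K) (Minimum (suc n))
  runs-keepBest {σ} {n} #≡K best θcur≡ stores = runs-when {e = better?} (keep best ∘ ¬better? σ) λ c nz →
    (θm ≔ var θcur) next (finite ≔ lit 1) next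
    weaken (λ σ′ A copied → record
      { isFinite = A (scalarN finite) refl
      ; index    = n
      ; θm-≡     = trans (A (scalarN θm) refl) θcur≡
      ; ordm-≡   = λ x → trans (copied (toℕ x) (Fin.toℕ<n x)) (stores x)
      ; minimal  = λ t t<1+n → ≤-trans (≤-reflexive (A (scalarN θm) refl))
                                  (least best (better?-true σ nz) t t<1+n)
      })
      (runs-for (λ a σ′ → ∀ x → x < a → array σ′ ordm x ≡ array σ ordcur x) #≡K (λ _ ())
        λ a σ′ _ A I → basic λ x x<1+a → copy σ′ a (A (arrayN ordcur) refl) I x (m<1+n⇒m<n∨m≡n x<1+a))
    where
    copy : ∀ σ′ a → array σ′ ordcur ≡ array σ ordcur →
           (∀ x → x < a → array σ′ ordm x ≡ array σ ordcur x) →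
           ∀ x → x < a ⊎ x ≡ a → (array σ′ ordm [ a ↦ array σ′ ordcur a ]) x ≡ array σ ordcur x
    copy σ′ a same I x x<a∨x≡a with a ≟ x | x<a∨x≡a
    ... | yes refl | _        = trans (update-same {f = array σ′ ordm} x refl) (cong (λ f → f x) same)
    ... | no a≢x   | inj₁ x<a = trans (update-other {f = array σ′ ordm} x a≢x) (I x x<a)
    ... | no a≢x   | inj₂ x≡a = contradiction (sym x≡a) a≢x
    keep : Best n σ → scalar σ finite ≢ 0 × scalar σ θm ≤ scalar σ θcur → Minimum (suc n) σ
    keep (inj₁ (_ , finite≡0)) (finite≢0 , _) = contradiction finite≡0 finite≢0
    keep (inj₂ μ) (_ , θm≤θcur) = record
      { isFinite = isFinite μ
      ; index    = index μ
      ; θm-≡     = θm-≡ μ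
      ; ordm-≡   = ordm-≡ μ
      ; minimal  = λ t t<1+n → case t (m<1+n⇒m<n∨m≡n t<1+n)
      }
      where
      case : ∀ t → t < n ⊎ t ≡ n → scalar σ θm ≤ orderCost M (shuffle t K)
      case t (inj₁ t<n)  = minimal μ t t<n
      case t (inj₂ refl) = ≤-trans θm≤θcur (≤-reflexive θcur≡)
    least : Best n σ → scalar σ finite ≡ 0 ⊎ scalar σ θcur < scalar σ θm →
            ∀ t → t < suc n → scalar σ θcur ≤ orderCost M (shuffle t K)
    least best better t t<1+n with m<1+n⇒m<n∨m≡n t<1+n
    ... | inj₂ refl = ≤-reflexive θcur≡
    ... | inj₁ t<n  with best | better
    ...   | inj₁ (refl , _) | _ with () ← t<n
    ...   | inj₂ μ | inj₁ finite≡0 with () ← trans (sym (isFinite μ)) finite≡0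
    ...   | inj₂ μ | inj₂ θcur<θm = ≤-trans (<⇒≤ θcur<θm) (minimal μ t t<n)

  runs-tryOrder : ∀ {σ n} → scalar σ #channels ≡ K → scalar σ 𝐭 ≡ n →
    (∀ a b → a < K → b < K → a ≢ b → matrix σ 𝐦 a b ≡ M a b) →
    Best n σ → Runs tryOrder σ (steps-tryOrder K) (Minimum (suc n))
  runs-tryOrder {σ} {n} #≡K refl m≡M best =
    runs-decodeOrder #≡K then λ σ₁ A₁ stores →
    runs-computeK (trans (A₁ (scalarN #channels) refl) #≡K) then λ σ₂ A₂ k≡ →
    runs-computeθ (trans (A₂ (scalarN #channels) refl) (trans (A₁ (scalarN #channels) refl) #≡K))
      then λ σ₃ A₃ θ≡ →
    let frame : ∀ v → writes decodeOrder v ≡ false → writes computeK v ≡ false →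
                writes computeθ v ≡ false → content σ₃ v ≡ content σ v
        frame v w₁ w₂ w₃ = trans (A₃ v w₃) (trans (A₂ v w₂) (A₁ v w₁))
        ordcur≡ : array σ₃ ordcur ≡ array σ₁ ordcur
        ordcur≡ = trans (A₃ (arrayN ordcur) refl) (A₂ (arrayN ordcur) refl)
    in runs-keepBest (trans (frame (scalarN #channels) refl refl refl) #≡K)
      (transport σ₃ (frame (scalarN finite) refl refl refl) (frame (scalarN θm) refl refl refl)
        (frame (arrayN ordm) refl refl refl) best)
      (trans θ≡ (offDiagonal-orderCost M (shuffle n K) {array σ₁ ordcur} stores λ a b a<K b<K a≢b →
        cong₂ _*_ (trans (cong (λ f → f a b) (trans (A₂ (matrixN 𝐦) refl) (A₁ (matrixN 𝐦) refl)))
                         (m≡M a b a<K b<K a≢b))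
                  (k≡ a b a<K b<K a≢b)))
      (λ x → trans (cong (λ f → f (toℕ x)) ordcur≡) (stores x))
    where
    transport : ∀ σ′ → scalar σ′ finite ≡ scalar σ finite → scalar σ′ θm ≡ scalar σ θm →
                array σ′ ordm ≡ array σ ordm → Best n σ → Best n σ′
    transport σ′ f≡ θ≡ o≡ (inj₁ (n≡0 , finite≡0)) = inj₁ (n≡0 , trans f≡ finite≡0)
    transport σ′ f≡ θ≡ o≡ (inj₂ μ) = inj₂ record
      { isFinite = trans f≡ (isFinite μ)
      ; index    = index μ
      ; θm-≡     = trans θ≡ (θm-≡ μ)
      ; ordm-≡   = λ x → trans (cong (λ f → f (toℕ x)) o≡) (ordm-≡ μ x)
      ; minimal  = λ t t<n → ≤-trans (≤-reflexive θ≡) (minimal μ t t<n)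
      }

steps-bestOrder : ℕ → ℕ → ℕ
steps-bestOrder K E =
  steps-countCrossEdges K E + (steps-countOrders K + (2 + (2 + K ! * (1 + steps-tryOrder K))))

runs-bestOrder : ∀ {σ K E} → scalar σ #channels ≡ K → scalar σ #edges ≡ E →
  Runs bestOrder σ (steps-bestOrder K E)
    (Minimum {K} (edgesBetween (array σ chan ∘ array σ src) (array σ chan ∘ array σ tgt) E) (K !))
runs-bestOrder {σ} {K} {E} #≡K #≡E =
  runs-countCrossEdges #≡K #≡E then λ σ₁ A₁ m≡ →
  runs-countOrders (trans (A₁ (scalarN #channels) refl) #≡K) then λ σ₂ A₂ orders≡ →
  (finite ≔ lit 0) next
  weaken (λ _ _ → nonempty)
    (runs-for {s = tryOrder} (Best M) orders≡ (inj₁ (refl , refl)) λ n σ₃ _ A₃ best →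
      let A : ∀ v → writes (for 𝐭 (var #orders) tryOrder) v ≡ false → writes countOrders v ≡ false →
              writes (finite ≔ lit 0) v ≡ false → content σ₃ v ≡ content σ₁ v
          A v w₁ w₂ w₃ = trans (A₃ v w₁) (trans (agree (finite ≔ lit 0) σ₂ v w₃) (A₂ v w₂))
      in weaken (λ _ _ → inj₂) (runs-tryOrder M
        (trans (A (scalarN #channels) refl refl refl) (trans (A₁ (scalarN #channels) refl) #≡K)) refl
        (λ a b a<K b<K a≢b → trans (cong (λ f → f a b) (A (matrixN 𝐦) refl refl refl))
                                    (m≡ a b a<K b<K a≢b))
        (stable σ₃ n best)))
  where
  M = edgesBetween (array σ chan ∘ array σ src) (array σ chan ∘ array σ tgt) E
  stable : ∀ σ′ n → Best M n σ′ → Best M n (setScalar 𝐭 n σ′)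
  stable σ′ n (inj₁ p) = inj₁ p
  -- No field mentions `𝐭`: the types of the fields before and after the assignment reduce to the
  -- same.
  stable σ′ n (inj₂ μ) = inj₂ record { Minimum μ }
  nonempty : ∀ {σ′} → Best M (K !) σ′ → Minimum M (K !) σ′
  nonempty (inj₂ μ) = μ
  -- Even with no channels there is one order, so the loop runs at least once.
  nonempty (inj₁ (K!≡0 , _)) with K ! | 1≤n! K
  ... | suc _ | _ with () ← K!≡0

-- A bijection from `Fin K` to `Fin L` forces the sizes to be equal. Casting its values keeps them
-- as numbers, so `shuffle-onto` applies, with nothing encoded beyond the first `K` digits.
orderCost-minimal : ∀ {K} M c → (∀ t → t < K ! → c ≤ orderCost M (shuffle t K)) →
            ∀ {L} (π : Permutation K L) → c ≤ orderCost M π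
orderCost-minimal {K} M c minimal π
  with shuffle-onto K (π ∘ₚ Permutation.cast-id (sym (Permutation.↔⇒≡ π)))
... | t , t<K! , decodes = ≤-trans (minimal t t<K!) (≤-reflexive (sum-cong-≗ λ x → sum-cong-≗ λ y →
      cong (if does (x Fin.≟ y) then 0 else_)
        (cong₂ (λ p q → M (toℕ x) (toℕ y) * (∣ p - q ∣ ∸ 1)) (same x) (same y))))
  where
  same : ∀ x → toℕ (shuffle t K ⟨$⟩ʳ x) ≡ toℕ (π ⟨$⟩ʳ x)
  same x = trans
    (cong (λ z → toℕ (shuffle z K ⟨$⟩ʳ x))
      (sym (trans (cong (t +_) (*-zeroʳ (K !))) (+-identityʳ t))))
    (trans (cong toℕ (proj₂ (decodes 0) x)) (Fin.toℕ-cast _ _))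

-- θ of a drawing

length-filter-tabulate : ∀ {A : Set} {P : A → Set} (P? : Decidable P) {n} (f : Fin n → A) →
                         length (filter P? (tabulate f)) ≡ sum λ x → fromBool (does (P? (f x)))
length-filter-tabulate P? {zero}  f = refl
length-filter-tabulate P? {suc n} f with does (P? (f Fin.zero))
... | true  = cong suc (length-filter-tabulate P? (f ∘ Fin.suc))
... | false = length-filter-tabulate P? (f ∘ Fin.suc)

-- The cut-off `n ⊓ b` makes the count inductive in `n`: it can grow only until `b` is reached.
-- Truncated subtraction gives 0 as long as `n` is at most `suc a`.
sumTo-interval : ∀ a b n → sumTo n (λ z → fromBool (does ((a <? z) ×-dec (z <? b)))) ≡ (n ⊓ b) ∸ suc a
sumTo-interval a b zero = refl
sumTo-interval a b (suc n) =
  trans (sumTo-suc n inside)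
    (trans (cong (_+ inside n) (sumTo-interval a b n)) (step (a <? n) (n <? b)))
  where
  inside : ℕ → ℕ
  inside z = fromBool (does ((a <? z) ×-dec (z <? b)))
  step : Dec (a < n) → Dec (n < b) → (n ⊓ b) ∸ suc a + inside n ≡ (suc n ⊓ b) ∸ suc a
  step (yes a<n) (yes n<b)
    rewrite dec-true (a <? n) a<n | dec-true (n <? b) n<b | m≤n⇒m⊓n≡m (<⇒≤ n<b) | m≤n⇒m⊓n≡m n<b
    = trans (+-comm _ 1) (sym (+-∸-assoc 1 a<n))
  step (no a≮n) (yes n<b)
    rewrite dec-false (a <? n) a≮n | m≤n⇒m⊓n≡m (<⇒≤ n<b) | m≤n⇒m⊓n≡m n<b
    = trans (+-identityʳ _) (trans (m≤n⇒m∸n≡0 (m≤n⇒m≤1+n (≮⇒≥ a≮n))) (sym (m≤n⇒m∸n≡0 (≮⇒≥ a≮n))))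
  step a<?n (no n≮b)
    rewrite dec-false ((a <? n) ×-dec (n <? b)) (n≮b ∘ proj₂)
          | m≥n⇒m⊓n≡n (≮⇒≥ n≮b) | m≥n⇒m⊓n≡n (m≤n⇒m≤1+n (≮⇒≥ n≮b))
    = +-identityʳ _

strictlyBetween? : ∀ a b → Decidable (λ z → (a < z × z < b) ⊎ (b < z × z < a))
strictlyBetween? a b z = ((a <? z) ×-dec (z <? b)) ⊎-dec ((b <? z) ×-dec (z <? a))

-- For `a ≤ b` the second alternative is empty, and for `a ≡ b` truncation makes both sides 0.
sumTo-between-≤ : ∀ {a b n} → a ≤ b → b < n →
                  sumTo n (λ z → fromBool (does (strictlyBetween? a b z))) ≡ ∣ a - b ∣ ∸ 1
sumTo-between-≤ {a} {b} {n} a≤b b<n = begin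
  sumTo n (λ z → fromBool (does (strictlyBetween? a b z)))
    ≡⟨ sum-cong-≗ {n} (λ z → cong fromBool (does-⇔ (mk⇔ increasing inj₁)
         (strictlyBetween? a b (toℕ z)) ((a <? toℕ z) ×-dec (toℕ z <? b)))) ⟩
  sumTo n (λ z → fromBool (does ((a <? z) ×-dec (z <? b))))
    ≡⟨ sumTo-interval a b n ⟩
  (n ⊓ b) ∸ suc a
    ≡⟨ cong₂ _∸_ (m≥n⇒m⊓n≡n (<⇒≤ b<n)) (+-comm 1 a) ⟩
  b ∸ (a + 1)
    ≡⟨ ∸-+-assoc b a 1 ⟨
  b ∸ a ∸ 1
    ≡⟨ cong (_∸ 1) (m≤n⇒∣m-n∣≡n∸m a≤b) ⟨
  ∣ a - b ∣ ∸ 1 ∎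
  where
  open ≡-Reasoning
  increasing : ∀ {z} → (a < z × z < b) ⊎ (b < z × z < a) → a < z × z < b
  increasing (inj₁ p)           = p
  increasing (inj₂ (b<z , z<a)) = contradiction a≤b (<⇒≱ (<-trans b<z z<a))

sumTo-between : ∀ a b n → a < n → b < n →
                sumTo n (λ z → fromBool (does (strictlyBetween? a b z))) ≡ ∣ a - b ∣ ∸ 1
sumTo-between a b n a<n b<n with ≤-total a b
... | inj₁ a≤b = sumTo-between-≤ a≤b b<n
... | inj₂ b≤a = trans
  (sum-cong-≗ {n} λ z → cong fromBool
    (does-⇔ (mk⇔ swap swap) (strictlyBetween? a b (toℕ z)) (strictlyBetween? b a (toℕ z))))
  (trans (sumTo-between-≤ b≤a a<n) (cong (_∸ 1) (∣-∣-comm b a)))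

module _ {n : ℕ} {G : DAG n} where

  -- Doubling is strictly monotone, so comparing abscissas amounts to comparing positions;
  -- reindexing by the bijection `order` then turns a count of channels into a count of numbers
  -- below the size.
  between-CCHDraw : ∀ (O : OrderedChannelDecomposition G) I τ i j →
    let open OrderedChannelDecomposition O in
    between (CCHDraw O I τ) i j ≡ ∣ toℕ (order ⟨$⟩ʳ i) - toℕ (order ⟨$⟩ʳ j) ∣ ∸ 1
  between-CCHDraw O I τ i j = begin
    between (CCHDraw O I τ) i j
      ≡⟨ length-filter-tabulate drawnBetween? {OrderedChannelDecomposition.size O} (λ c → c) ⟩
    sum (λ c → fromBool (does (drawnBetween? c)))
      ≡⟨ sum-cong-≗ (λ c → cong fromBool (does-⇔
           (mk⇔ (map (map× halve halve) (map× halve halve)) (map (map× double double) (map× double double)))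
           (drawnBetween? c) (strictlyBetween? (pos i) (pos j) (pos c)))) ⟩
    sum (λ c → fromBool (does (strictlyBetween? (pos i) (pos j) (pos c))))
      ≡⟨ sum-permute (λ z → fromBool (does (strictlyBetween? (pos i) (pos j) (toℕ z)))) order ⟨
    sumTo size′ (λ z → fromBool (does (strictlyBetween? (pos i) (pos j) z)))
      ≡⟨ sumTo-between (pos i) (pos j) size′ (Fin.toℕ<n _) (Fin.toℕ<n _) ⟩
    ∣ pos i - pos j ∣ ∸ 1 ∎
    where
    open ≡-Reasoning
    open OrderedChannelDecomposition O renaming (size to size′)
    open Drawing (CCHDraw O I τ) using (X)
    pos : Fin size′ → ℕ
    pos c = toℕ (order ⟨$⟩ʳ c)
    drawnBetween? : Decidable (λ c → (X i < X c × X c < X j) ⊎ (X j < X c × X c < X i))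
    drawnBetween? c = ((X i <? X c) ×-dec (X c <? X j)) ⊎-dec ((X j <? X c) ×-dec (X c <? X i))
    halve : ∀ {x y} → 2 * suc x < 2 * suc y → x < y
    halve p = ≤-pred (*-cancelˡ-< 2 _ _ p)
    double : ∀ {x y} → x < y → 2 * suc x < 2 * suc y
    double p = *-monoʳ-< 2 (s≤s p)

  -- Renumbering of channels

  module _ (S : ChannelDecomposition G) where
    open ChannelDecomposition S

    ∈-channel⇔ : ∀ v c → v ∈ channel c ⇔ (toℕ (channelOf v) ≡ toℕ c)
    ∈-channel⇔ v c = mk⇔ (λ v∈ → cong toℕ (proj₂ (proj₂ (partition v)) v∈))
      (λ p → subst (λ c → v ∈ channel c) (Fin.toℕ-injective p) (proj₁ (proj₂ (partition v))))

    -- A channel has a vertex, and a vertex common to two channels identifies their indices.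
    channel-injective : ∀ {c d} → channel c ≡ channel d → c ≡ d
    channel-injective {c} {d} c≡d with channel c in eqc | nonempty c
    ... | []    | ne = contradiction refl ne
    ... | v ∷ _ | _  = trans
      (sym (unique (subst (v ∈_) (sym eqc) (here refl))))
      (unique (subst (v ∈_) c≡d (here refl)))
      where unique = proj₂ (proj₂ (partition v))

  -- Both index maps come from the equality of the sets of channels; they are mutually inverse since
  -- an index is determined by its channel.
  sameChannels-permutation : ∀ {S T : ChannelDecomposition G} → SameChannels S T →
    ∃[ π ] (∀ c → ChannelDecomposition.channel T (π ⟨$⟩ʳ c) ≡ ChannelDecomposition.channel S c)
  sameChannels-permutation {S} {T} same =
    permutation (proj₁ ∘ to) (proj₁ ∘ from)
      (λ d → channel-injective T (trans (proj₂ (to (proj₁ (from d)))) (proj₂ (from d))))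
      (λ c → channel-injective S (trans (proj₂ (from (proj₁ (to c)))) (proj₂ (to c))))
    , proj₂ ∘ to
    where
    module 𝒮 = ChannelDecomposition S
    module 𝒯 = ChannelDecomposition T
    to : ∀ c → ∃ λ d → 𝒯.channel d ≡ 𝒮.channel c
    to c = Equivalence.to (same (𝒮.channel c)) (c , refl)
    from : ∀ d → ∃ λ c → 𝒮.channel c ≡ 𝒯.channel d
    from d = Equivalence.from (same (𝒯.channel d)) (d , refl)

  module _ (S : ChannelDecomposition G) (I : List (Fin n × Fin n)) (A B : ℕ → ℕ)
           (A≡ : ∀ x → A (toℕ x) ≡ toℕ (ChannelDecomposition.channelOf S (proj₁ (lookup I x))))
           (B≡ : ∀ x → B (toℕ x) ≡ toℕ (ChannelDecomposition.channelOf S (proj₂ (lookup I x)))) where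
    open ChannelDecomposition S renaming (size to K)
    open DecMembership (Fin._≟_ {n}) using (_∈?_)

    M : ℕ → ℕ → ℕ
    M = edgesBetween A B (length I)

    length-filter-edges : ∀ c d →
      length (filter (λ e → (proj₁ e ∈? channel c) ×-dec (proj₂ e ∈? channel d)) I) ≡ M (toℕ c) (toℕ d)
    length-filter-edges c d = begin
      length (filter P? I)
        ≡⟨ cong (length ∘ filter P?) (tabulate-lookup I) ⟨
      length (filter P? (tabulate (lookup I)))
        ≡⟨ length-filter-tabulate P? (lookup I) ⟩
      sum (λ x → fromBool (does (P? (lookup I x))))
        ≡⟨ sum-cong-≗ (λ x → cong fromBool (cong₂ _∧_ (member (A≡ x) c) (member (B≡ x) d))) ⟩
      M (toℕ c) (toℕ d) ∎
      where
      open ≡-Reasoning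
      P? = λ (e : Fin n × Fin n) → (proj₁ e ∈? channel c) ×-dec (proj₂ e ∈? channel d)
      member : ∀ {a v} → a ≡ toℕ (channelOf v) → ∀ c → does (v ∈? channel c) ≡ (a ≡ᵇ toℕ c)
      member {v = v} refl c = does-⇔ (∈-channel⇔ S v c) (v ∈? channel c) (toℕ (channelOf v) ≟ toℕ c)

    -- The sums run over the channels of `O`; reindexing both by `π` expresses them in the numbering
    -- of `S`, the one in which the program counts edges.
    θ-CCHDraw : ∀ (O : OrderedChannelDecomposition G) τ
      (π : Permutation K (OrderedChannelDecomposition.size O)) →
      (∀ c → OrderedChannelDecomposition.channel O (π ⟨$⟩ʳ c) ≡ channel c) →
      θ (CCHDraw O I τ) ≡ orderCost M (π ∘ₚ OrderedChannelDecomposition.order O)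
    θ-CCHDraw O τ π channel≡ =
      trans (sum-permute {n = O.size} _ π)
        (sum-cong-≗ λ x → trans (sum-permute {n = O.size} _ π) (sum-cong-≗ (entry x)))
      where
      module O = OrderedChannelDecomposition O
      Γ = CCHDraw O I τ
      entry : ∀ x y →
        (if does (π ⟨$⟩ʳ x Fin.≟ π ⟨$⟩ʳ y) then 0
         else crossEdges Γ (π ⟨$⟩ʳ x) (π ⟨$⟩ʳ y) * between Γ (π ⟨$⟩ʳ x) (π ⟨$⟩ʳ y)) ≡
        (if does (x Fin.≟ y) then 0
         else M (toℕ x) (toℕ y) *
              (∣ toℕ (O.order ⟨$⟩ʳ (π ⟨$⟩ʳ x)) - toℕ (O.order ⟨$⟩ʳ (π ⟨$⟩ʳ y)) ∣ ∸ 1))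
      entry x y
        rewrite does-⇔ (mk⇔ (Injection.injective (↔⇒↣ π)) (cong (π ⟨$⟩ʳ_)))
                  (π ⟨$⟩ʳ x Fin.≟ π ⟨$⟩ʳ y) (x Fin.≟ y)
        = cong (if does (x Fin.≟ y) then 0 else_) (cong₂ _*_
            (trans
              (cong₂ (λ C D → length (filter (λ e → (proj₁ e ∈? C) ×-dec (proj₂ e ∈? D)) I))
                     (channel≡ x) (channel≡ y))
              (length-filter-edges x y))
            (between-CCHDraw O I τ _ _))

-- With F = K!, steps-bestOrder K E is 12 + 10K + 5K² + 25F + 33FK + 34FK² + 23E,
-- whose coefficients other than that of E add up to 119.
steps-bestOrder≤ : ∀ {K E} → 1 ≤ K → steps-bestOrder K E ≤ 119 * (K ! * K ^ 2 + E)
steps-bestOrder≤ {K} {E} 1≤K = bound 1≤K (1≤n! K)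
  where
  open +-*-Solver
  steps²ᵖ : ∀ {n} → Polynomial n → Polynomial n → Polynomial n
  steps²ᵖ K T = con 2 :+ K :* (con 1 :+ (con 2 :+ K :* (con 1 :+ T)))
  -- `F` replaces `K !`, which keeps the factorial out of the polynomial arithmetic. With no
  -- channels `K ^ 2` would vanish while constant terms remain, hence `1 ≤ K`.
  bound : ∀ {K F} → 1 ≤ K → 1 ≤ F →
    steps-countCrossEdges K E + (steps-countOrders K + (4 + F * (1 + steps-tryOrder K))) ≤
      119 * (F * K ^ 2 + E)
  bound {suc k} {suc f} _ _ = ≤-trans
    -- After `K = 1 + k` and `F = 1 + f` the slack has only nonnegative coefficients. Its constant
    -- term is 0: the bound 119 is attained by `steps-bestOrder` for one channel and no edges.
    (m≤m+n _ (117 * k + 80 * (k * k) + 27 * f + 137 * (f * k) + 85 * (f * (k * k)) + 96 * E))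
    (≤-reflexive (solve 3 (λ k f E →
    let K = con 1 :+ k
        F = con 1 :+ f
    in
    (steps²ᵖ K (con 4) :+ (con 2 :+ E :* con 23) :+
      (con 4 :+ K :* con 7 :+
        (con 4 :+ F :* (con 1 :+ (con 4 :+ K :* con 22 :+
          (steps²ᵖ K (con 16) :+ (con 2 :+ steps²ᵖ K (con 16) :+ (con 14 :+ K :* con 5)))))))) :+
      (con 117 :* k :+ con 80 :* (k :* k) :+ con 27 :* f :+ con 137 :* (f :* k) :+
        con 85 :* (f :* (k :* k)) :+ con 96 :* E)
    := con 119 :* (F :* (K :* (K :* con 1)) :+ E)) refl k f E))

theorem5 : (∀ {n : ℕ} (G : DAG n) (S : ChannelDecomposition G) (I : List (Fin n × Fin n)) →
    IsCompressedClosure S I → ∀ σ → Input S I σ →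
    ∃[ O ] Returns S σ O ×
    (∀ (τ : TopologicalOrder G) (O′ : OrderedChannelDecomposition G) →
    SameChannels S (decomposition O′) →
    θ (CCHDraw O I τ) ≤ θ (CCHDraw O′ I τ)))
    ×
    (∃[ c ] ∀ {n : ℕ} (G : DAG n) (S : ChannelDecomposition G) (I : List (Fin n × Fin n)) →
    IsCompressedClosure S I → ∀ σ → Input S I σ →
    1 ≤ size S →
    time σ ≤ c * ((size S) ! * size S ^ 2 + length I))
theorem5 = optimal , 119 , λ G S I _ σ input 1≤size →
  ≤-trans (time≤ (runs-bestOrder {σ} (Input.channels-≡ input) (Input.edges-≡ input)))
          (steps-bestOrder≤ 1≤size)
  where
  optimal : ∀ {n : ℕ} (G : DAG n) (S : ChannelDecomposition G) (I : List (Fin n × Fin n)) →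
    IsCompressedClosure S I → ∀ σ → Input S I σ →
    ∃[ O ] Returns S σ O ×
    (∀ (τ : TopologicalOrder G) (O′ : OrderedChannelDecomposition G) →
    SameChannels S (decomposition O′) →
    θ (CCHDraw O I τ) ≤ θ (CCHDraw O′ I τ))
  optimal G S I _ σ input =
    O , record { same-decomposition = refl ; ordm-≡ = ordm-≡ } , λ τ O′ same →
      let π , channel≡ = sameChannels-permutation {S = S} {decomposition O′} same
      in begin
        θ (CCHDraw O I τ)
          -- `O` numbers its channels as `S` does.
          ≡⟨ θ-CCHDraw S I A B A≡ B≡ O τ Permutation.id (λ _ → refl) ⟩
        orderCost W (shuffle index (size S))
          ≡⟨ θm-≡ ⟨
        scalar (proj₁ (exec bestOrder σ)) θm
          ≤⟨ orderCost-minimal W _ minimal (π ∘ₚ OrderedChannelDecomposition.order O′) ⟩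
        orderCost W (π ∘ₚ OrderedChannelDecomposition.order O′)
          ≡⟨ θ-CCHDraw S I A B A≡ B≡ O′ τ π channel≡ ⟨
        θ (CCHDraw O′ I τ) ∎
    where
    open ≤-Reasoning
    open Input input
    open Minimum (post (runs-bestOrder {σ} channels-≡ edges-≡))
    open ChannelDecomposition S using (channelOf)
    -- The answer is the order of the recorded code, which is the one stored in `ordm`.
    O = record { decomposition = S ; order = shuffle index (size S) }
    A = array σ chan ∘ array σ src
    B = array σ chan ∘ array σ tgt
    W = edgesBetween A B (length I)
    A≡ : ∀ x → A (toℕ x) ≡ toℕ (channelOf (proj₁ (lookup I x)))
    A≡ x = trans (cong (array σ chan) (src-≡ x)) (chan-≡ _)
    B≡ : ∀ x → B (toℕ x) ≡ toℕ (channelOf (proj₂ (lookup I x)))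
    B≡ x = trans (cong (array σ chan) (tgt-≡ x)) (chan-≡ _)
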